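{- Let $G$ be a subcubic graph. Then $\chi_p(D(G))\le 6$.
   Context: Graphs are finite and simple. A graph is subcubic if its maximum degree is at most $3$. The $1$-subdivision $D(G)$ of a graph $G$ is obtained from $G$ by replacing every edge with a path of two edges (i.e. inserting one new vertex of degree $2$ on each edge). The distance between two vertices is the number of edges of a shortest path between them (infinite if they lie in different components). For a non-decreasing sequence $S=(s_1,\ldots,s_k)$ of positive integers, a packing $S$-coloring of a graph $F$ is a partition of $V(F)$ into $V_1,\ldots,V_k$ (parts may be empty) such that for every $1\le i\le k$ and every pair of distinct vertices $u,v\in V_i$, the distance between $u$ and $v$ in $F$ is at least $s_i+1$. The packing chromatic number $\chi_p(F)$ is the smallest integer $k$ such that $F$ has a packing $(1,2,\ldots,k)$-coloring. -}

module Defs where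

open import Data.Empty using (⊥)
open import Data.Fin.Base using (Fin; toℕ; splitAt)
open import Data.Fin.Properties using (_≟_; _<?_; any?; all?)
open import Data.List.Base as List using (List; allFin; cartesianProduct; filter; length)
open import Data.Nat.Base as ℕ using (ℕ; zero; suc; _+_; _≤_)
import Data.Nat.Properties as ℕ
open import Data.Product using (∃; Σ-syntax; _×_; _,_; proj₁; proj₂)
open import Data.Sum.Base using (_⊎_; inj₁; inj₂)
open import Data.Vec.Base as Vec using (Vec; []; _∷_; head; last; lookup; tabulate)
import Data.Vec.Properties as Vec
open import Data.Vec.Relation.Unary.AllPairs using (allPairs?)
open import Data.Vec.Relation.Unary.Linked using (Linked; linked?)
open import Data.Vec.Relation.Unary.Unique.Propositional using (Unique)
open import Function.Base using (_∘_; id)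
open import Relation.Binary.PropositionalEquality
  using (_≡_; _≢_; refl; sym; trans; subst)
open import Relation.Nullary
  using (¬_; Dec; yes; no; ¬?; contradiction; map′; _×-dec_; _⊎-dec_; _→-dec_)
open import Relation.Unary using (Decidable)

------------------------------------------------------------------------
-- Finite simple graphs

-- Adjacency is a decidable relation; its proofs carry no content, as
-- edges are counted through the decision procedure.

record Graph : Set₁ where
  infix 4 _~_ _~?_
  field
    order    : ℕ
    _~_      : Fin order → Fin order → Set
    _~?_     : ∀ u v → Dec (u ~ v)
    ~-sym    : ∀ {u v} → u ~ v → v ~ u
    ~-irrefl : ∀ {v} → ¬ (v ~ v)

  Vertex : Set
  Vertex = Fin order

  degree : Vertex → ℕ
  degree v = length (filter (v ~?_) (allFin order))

  -- Each edge occurs exactly once, with its smaller endpoint first.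
  edges : List (Vertex × Vertex)
  edges = filter (λ (u , v) → (u <? v) ×-dec (u ~? v))
                 (cartesianProduct (allFin order) (allFin order))

Subcubic : Graph → Set
Subcubic G = ∀ v → degree v ≤ 3
  where open Graph G

------------------------------------------------------------------------
-- The 1-subdivision

-- The first  order  vertices are those of G; the others are indexed by
-- the positions in the list of edges, each joined to the two endpoints
-- of its edge.

module _ (G : Graph) where
  open Graph G

  Incident : Vertex → Fin (length edges) → Set
  Incident v e = v ≡ proj₁ (List.lookup edges e) ⊎ v ≡ proj₂ (List.lookup edges e)

  SubdivAdj : Vertex ⊎ Fin (length edges) → Vertex ⊎ Fin (length edges) → Set
  SubdivAdj (inj₁ v) (inj₂ e) = Incident v e
  SubdivAdj (inj₂ e) (inj₁ v) = Incident v e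
  SubdivAdj (inj₁ _) (inj₁ _) = ⊥
  SubdivAdj (inj₂ _) (inj₂ _) = ⊥

  private
    incident? : ∀ v e → Dec (Incident v e)
    incident? v e = (v ≟ _) ⊎-dec (v ≟ _)

    subdivAdj? : ∀ x y → Dec (SubdivAdj x y)
    subdivAdj? (inj₁ v) (inj₂ e) = incident? v e
    subdivAdj? (inj₂ e) (inj₁ v) = incident? v e
    subdivAdj? (inj₁ _) (inj₁ _) = no id
    subdivAdj? (inj₂ _) (inj₂ _) = no id

    subdivAdj-sym : ∀ x y → SubdivAdj x y → SubdivAdj y x
    subdivAdj-sym (inj₁ _) (inj₂ _) p = p
    subdivAdj-sym (inj₂ _) (inj₁ _) p = p

    subdivAdj-irrefl : ∀ x → ¬ SubdivAdj x x
    subdivAdj-irrefl (inj₁ _) ()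
    subdivAdj-irrefl (inj₂ _) ()

  D : Graph
  D = record
    { order    = order + length edges
    ; _~_      = λ x y → SubdivAdj (splitAt order x) (splitAt order y)
    ; _~?_     = λ x y → subdivAdj? (splitAt order x) (splitAt order y)
    ; ~-sym    = λ {x} {y} → subdivAdj-sym (splitAt order x) (splitAt order y)
    ; ~-irrefl = λ {x} → subdivAdj-irrefl (splitAt order x)
    }

------------------------------------------------------------------------
-- Distance and packing colorings

module _ (F : Graph) where
  open Graph F

  record IsPath (u v : Vertex) {d : ℕ} (p : Vec Vertex (suc d)) : Set where
    constructor isPath
    field
      starts   : head p ≡ u
      ends     : last p ≡ v
      linked   : Linked _~_ p
      distinct : Unique p

  -- The index d is the number of edges.
  Path : Vertex → Vertex → ℕ → Set
  Path u v d = Σ[ p ∈ Vec Vertex (suc d) ] IsPath u v p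

  -- Vertices in different components have no (finite) distance.
  IsDistance : Vertex → Vertex → ℕ → Set
  IsDistance u v d = Path u v d × (∀ d′ → Path u v d′ → d ≤ d′)

  -- An infinite distance satisfies every lower bound.
  DistanceAtLeast : Vertex → Vertex → ℕ → Set
  DistanceAtLeast u v m = ∀ d → IsDistance u v d → m ≤ d

  -- The part V_i is the preimage of i, so parts may be empty.
  IsPackingColoring : ∀ {k} → (Fin k → ℕ) → (Vertex → Fin k) → Set
  IsPackingColoring S c =
    ∀ u v → u ≢ v → c u ≡ c v → DistanceAtLeast u v (S (c u) + 1)

  PackingColorable : ∀ {k} → (Fin k → ℕ) → Set
  PackingColorable {k} S = Σ[ c ∈ (Vertex → Fin k) ] IsPackingColoring S c

-- The sequence (1, 2, …, k).
oneTo : ∀ k → Fin k → ℕ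
oneTo k i = suc (toℕ i)

------------------------------------------------------------------------
-- The packing chromatic number

private

  anyVec? : ∀ {m n} {P : Vec (Fin m) n → Set} → Decidable P → Dec (∃ P)
  anyVec? {n = zero}  P? = map′ ([] ,_) (λ { ([] , p) → p }) (P? [])
  anyVec? {n = suc n} P? =
    map′ (λ { (x , xs , p) → x ∷ xs , p }) (λ { (x ∷ xs , p) → x , xs , p })
         (any? λ x → anyVec? λ xs → P? (x ∷ xs))

  lowerBound? : {P : ℕ → Set} → Decidable P → ∀ m → Dec (∀ j → P j → m ≤ j)
  lowerBound? P? m =
    map′ (λ f j p → ℕ.≮⇒≥ λ (j<m : suc j ℕ.≤ m) → f j<m p)
         (λ g {j} j<m p → ℕ.<⇒≱ j<m (g j p))
         (ℕ.allUpTo? (¬? ∘ P?) m)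

  least : {P : ℕ → Set} → Decidable P → ∃ P → ∃ λ k → P k × (∀ j → P j → k ≤ j)
  least {P} P? (m , p) = search m 0 (ℕ.+-identityʳ m) λ _ _ → ℕ.z≤n
    where
    search : ∀ gap k → gap + k ≡ m → (∀ j → P j → k ≤ j) →
             ∃ λ k → P k × (∀ j → P j → k ≤ j)
    search gap k eq lb with P? k
    search gap       k eq   lb | yes q = k , q , lb
    search zero      k refl lb | no ¬q = contradiction p ¬q
    search (suc gap) k eq   lb | no ¬q =
      search gap (suc k) (trans (ℕ.+-suc gap k) eq)
        λ j q → ℕ.≤∧≢⇒< (lb j q) λ { refl → ¬q q }

module _ (F : Graph) where
  open Graph F

  private
    path? : ∀ u v → Decidable (Path F u v)
    path? u v d = anyVec? λ p →
      map′ (λ (a , b , l , q) → isPath a b l q) (λ (isPath a b l q) → a , b , l , q)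
        ((head p ≟ u) ×-dec (last p ≟ v) ×-dec linked? _~?_ p
          ×-dec allPairs? (λ x y → ¬? (x ≟ y)) p)

    isDistance? : ∀ u v → Decidable (IsDistance F u v)
    isDistance? u v d = path? u v d ×-dec lowerBound? (path? u v) d

    isPackingColoring? : ∀ {k} (S : Fin k → ℕ) → Decidable (IsPackingColoring F S)
    isPackingColoring? S c = all? λ u → all? λ v →
      ¬? (u ≟ v) →-dec (c u ≟ c v) →-dec lowerBound? (isDistance? u v) (S (c u) + 1)

    respects : ∀ {k} (S : Fin k → ℕ) {c c′ : Vertex → Fin k} → (∀ v → c v ≡ c′ v) →
               IsPackingColoring F S c → IsPackingColoring F S c′
    respects S c≗c′ ok u v u≢v eq =
      subst (λ i → DistanceAtLeast F u v (S i + 1)) (c≗c′ u)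
        (ok u v u≢v (trans (c≗c′ u) (trans eq (sym (c≗c′ v)))))

    packingColorable? : ∀ {k} (S : Fin k → ℕ) → Dec (PackingColorable F S)
    packingColorable? S =
      map′ (λ (xs , ok) → lookup xs , ok)
           (λ (c , ok) → tabulate c , respects S (sym ∘ Vec.lookup∘tabulate c) ok)
           (anyVec? λ xs → isPackingColoring? S (lookup xs))

    -- Giving every vertex its own color is always a packing coloring.
    allDistinct : PackingColorable F (oneTo order)
    allDistinct = id , λ u v u≢v u≡v → contradiction u≡v u≢v

  leastPackingColorable :
    ∃ λ k → PackingColorable F (oneTo k)
          × (∀ j → PackingColorable F (oneTo j) → k ≤ j)
  leastPackingColorable =
    least (λ k → packingColorable? (oneTo k)) (order , allDistinct)

  χₚ : ℕ
  χₚ = proj₁ leastPackingColorable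

{-# OPTIONS --safe #-}

-- Colour as much of G as possible with two proper colours; let F be the set of
-- uncoloured vertices.  It suffices to split F into two classes of vertices at
-- distance at least 3 and one class of vertices at distance at least 4: the
-- subdivision vertices take colour 1 and the five classes take 2, 3, 4, 5, 6.
--
-- Fix a maximal set R ⊆ F of roots at pairwise distances at least 4 and, among
-- the colourings with |F| minimal and R ⊆ F, choose one minimising the sum of
-- the distances d(v) from the vertices v of F to R.  Call the vertices of
-- F ∖ R tokens.  A token can be slid to a neighbour that is its only neighbour
-- of some colour.  Hence such a neighbour is not closer to R, tokens are
-- pairwise nonadjacent, and a coloured vertex has at most two token neighbours.
--
-- Two tokens conflict when they have a common neighbour; the conflict graph is
-- bipartite, which gives the two classes.  Indeed consider a cycle of k
-- conflicting tokens vᵢ and let wᵢ, which is coloured, be the common neighbour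
-- of vᵢ₋₁ and vᵢ.  Let σ be the number of i (switches) for which wᵢ and wᵢ₊₁ have
-- different colours.  At a nonswitch one of the two is closer to R than vᵢ, so
-- 2 Σ d(wᵢ) ≤ 2 Σ d(vᵢ) + 2σ.  Conversely, in one of the two directions of the
-- cycle, sliding vᵢ to wᵢ₊₁ from one switch to the next creates adjacent tokens,
-- hence increases the sum of distances, so that Σ d(wᵢ) ≥ Σ d(vᵢ) + σ; for σ = 0
-- all tokens are slid at once.  Equality makes d(wᵢ) change by 2 at each
-- nonswitch and not at all at a switch, so the parity of ⌊d(wᵢ)/2⌋ plus the
-- colour of wᵢ alternates, and k is even.

module Submission where

open import Defs
import Algebra.Properties.CommutativeMonoid.Sum
open import Data.Bool.Base using (Bool; true; false; not; _xor_; if_then_else_)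
import Data.Bool.Properties as Bool
open import Data.Bool.Solver using (module xor-∧-Solver)
open import Data.Empty using (⊥; ⊥-elim)
open import Data.Fin.Base as Fin
  using (Fin; zero; suc; punchIn; finToFun; funToFin; splitAt; join)
open import Data.Fin.Properties
  using (_≟_; _<?_; any?; all?; pigeonhole; punchInᵢ≢i; finToFun-funToFin; join-splitAt)
open import Data.List.Base as List
  using (List; []; _∷_; allFin; cartesianProduct; filter)
import Data.List.Membership.DecPropositional
open import Data.List.Membership.Propositional using (_∈_; _∉_; find; lose)
open import Data.List.Membership.Propositional.Properties
  using (∈-allFin; ∈-cartesianProduct⁺; ∈-filter⁺; ∈-lookup)
open import Data.List.Relation.Unary.All as All using (All; []; _∷_)
open import Data.List.Relation.Unary.All.Properties using (all-filter)
open import Data.List.Relation.Unary.Any as Any using (Any; here; there)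
open import Data.List.Relation.Unary.Any.Properties using (lookup-index)
open import Data.Maybe.Base using (Maybe; just; nothing; fromMaybe)
open import Data.Maybe.Properties as Maybe using (just-injective)
open import Data.Nat.Base
  using (ℕ; zero; suc; _+_; _*_; _∸_; _^_; _≤_; _<_; z≤n; s≤s; NonZero; ⌊_/2⌋)
open import Data.Nat.DivMod
  using (_%_; _/_; m%n<n; m≡m%n+[m/n]*n; [m+kn]%n≡m%n; [m+n]%n≡m%n; m<n⇒m%n≡m; n%n≡0)
open import Data.Nat.Induction using (<-rec)
open import Data.Nat.Properties as ℕ hiding (_≟_; _<?_)
open import Data.Nat.Tactic.RingSolver using (solve-∀)
open import Data.Product.Base using (∃; ∃₂; _×_; _,_; proj₁; proj₂; uncurry)
open import Data.Sum.Base using (_⊎_; inj₁; inj₂; [_,_]′)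
open import Data.Sum.Properties using (inj₁-injective)
open import Data.Vec.Base using (Vec; []; _∷_; head; last)
open import Data.Vec.Functional using (updateAt; removeAt)
open import Data.Vec.Functional.Properties using (updateAt-updates; updateAt-minimal)
open import Data.Vec.Relation.Unary.Linked using (Linked; [-]; _∷_)
open import Function.Base using (_∘_; case_of_; const)
open import Relation.Binary.Definitions using (Decidable; Symmetric)
open import Relation.Binary.PropositionalEquality
  using (_≡_; _≢_; _≗_; refl; sym; trans; cong; cong₂; subst; subst₂; module ≡-Reasoning)
open import Relation.Nullary
  using (¬_; Dec; yes; no; ¬?; contradiction; does; map′; _×-dec_; _⊎-dec_; _→-dec_; decidable-stable)

open xor-∧-Solver using (solve; _:+_; _:=_; con)
open Algebra.Properties.CommutativeMonoid.Sum +-0-commutativeMonoid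
  using (sum; sum-remove; sum-cong-≗)

-- Sums over initial segments of sequences

sumTo : ℕ → (ℕ → ℕ) → ℕ
sumTo zero    f = 0
sumTo (suc m) f = sumTo m f + f m

sumTo-cong : ∀ m {f g} → (∀ i → f i ≡ g i) → sumTo m f ≡ sumTo m g
sumTo-cong zero    f≗g = refl
sumTo-cong (suc m) f≗g = cong₂ _+_ (sumTo-cong m f≗g) (f≗g m)

sumTo-+ : ∀ m n f → sumTo (m + n) f ≡ sumTo m f + sumTo n (λ i → f (m + i))
sumTo-+ m zero    f = trans (cong (λ j → sumTo j f) (+-identityʳ m)) (sym (+-identityʳ _))
sumTo-+ m (suc n) f = begin
  sumTo (m + suc n) f                                   ≡⟨ cong (λ j → sumTo j f) (+-suc m n) ⟩
  sumTo (m + n) f + f (m + n)                           ≡⟨ cong (_+ f (m + n)) (sumTo-+ m n f) ⟩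
  sumTo m f + sumTo n (λ i → f (m + i)) + f (m + n)     ≡⟨ +-assoc (sumTo m f) _ _ ⟩
  sumTo m f + (sumTo n (λ i → f (m + i)) + f (m + n))   ∎
  where open ≡-Reasoning

sumTo-distrib : ∀ m f g → sumTo m (λ i → f i + g i) ≡ sumTo m f + sumTo m g
sumTo-distrib zero    f g = refl
sumTo-distrib (suc m) f g = begin
  sumTo m (λ i → f i + g i) + (f m + g m)   ≡⟨ cong (_+ (f m + g m)) (sumTo-distrib m f g) ⟩
  sumTo m f + sumTo m g + (f m + g m)       ≡⟨ interchange (sumTo m f) (sumTo m g) (f m) (g m) ⟩
  sumTo m f + f m + (sumTo m g + g m)       ∎
  where
  open ≡-Reasoning
  interchange : ∀ a b c d → a + b + (c + d) ≡ a + c + (b + d)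
  interchange = solve-∀

sumTo-suc : ∀ m f → f 0 + sumTo m (f ∘ suc) ≡ sumTo m f + f m
sumTo-suc m f = sym (sumTo-+ 1 m f)

sumTo-mono-≤ : ∀ m {f g} → (∀ i → i < m → f i ≤ g i) → sumTo m f ≤ sumTo m g
sumTo-mono-≤ zero    f≤g = z≤n
sumTo-mono-≤ (suc m) f≤g =
  +-mono-≤ (sumTo-mono-≤ m λ i i<m → f≤g i (m<n⇒m<1+n i<m)) (f≤g m ≤-refl)

-- Slack in a single term would make the total strictly smaller, so splitting off the last term
-- leaves no slack on either side.
sumTo-tight : ∀ m {f g} → (∀ i → i < m → f i ≤ g i) → sumTo m g ≤ sumTo m f →
              ∀ i → i < m → f i ≡ g i
sumTo-tight (suc m) {f} {g} f≤g Σg≤Σf i i<1+m with m<1+n⇒m<n∨m≡n i<1+m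
... | inj₁ i<m  = sumTo-tight m (λ i i<m → f≤g i (m<n⇒m<1+n i<m))
  (+-cancelʳ-≤ (g m) _ _ (≤-trans Σg≤Σf (+-monoʳ-≤ (sumTo m f) (f≤g m ≤-refl)))) i i<m
... | inj₂ refl = ≤-antisym (f≤g m ≤-refl)
  (+-cancelˡ-≤ (sumTo m f) _ _
    (≤-trans (+-monoˡ-≤ (g m) (sumTo-mono-≤ m λ i i<m → f≤g i (m<n⇒m<1+n i<m))) Σg≤Σf))

-- Parity

odd : ℕ → Bool
odd zero    = false
odd (suc n) = not (odd n)

odd-+ : ∀ m n → odd (m + n) ≡ odd m xor odd n
odd-+ zero    n = refl
odd-+ (suc m) n = trans (cong not (odd-+ m n)) (Bool.not-distribˡ-xor (odd m) (odd n))

odd-summand : ∀ m n → odd (m + n) ≡ true → odd m ≡ true ⊎ odd n ≡ true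
odd-summand m n eq with odd m | odd n | odd-+ m n
... | true  | _     | _   = inj₁ refl
... | false | true  | _   = inj₂ refl
... | false | false | eq′ = contradiction (trans (sym eq) eq′) λ()

alternating : ∀ k (β : ℕ → Bool) → (∀ i → i < k → β (suc i) ≡ not (β i)) →
              β k ≡ odd k xor β 0
alternating zero    β flip = refl
alternating (suc k) β flip = begin
  β (suc k)               ≡⟨ flip k ≤-refl ⟩
  not (β k)               ≡⟨ cong not (alternating k β λ i i<k → flip i (m<n⇒m<1+n i<k)) ⟩
  not (odd k xor β 0)     ≡⟨ Bool.not-distribˡ-xor (odd k) (β 0) ⟩
  not (odd k) xor β 0     ∎
  where open ≡-Reasoning

bit : Bool → ℕ
bit b = if b then 1 else 0

-- Used at a nonswitch, with `z` the distance of the token: the strictly closer neighbour makes up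
-- for the other, which is at most one step farther.
descent-bound : ∀ {a b z} → a < z → b ≤ suc z → a + b ≤ z + z
descent-bound {a} {b} {z} a<z b≤1+z = begin
  a + b       ≤⟨ +-monoʳ-≤ a b≤1+z ⟩
  a + suc z   ≡⟨ +-suc a z ⟩
  suc a + z   ≤⟨ +-monoˡ-≤ z a<z ⟩
  z + z       ∎
  where open ≤-Reasoning

equal-halves : ∀ {a b y} → a ≤ y → b ≤ y → a + b ≡ y + y → a ≡ b
equal-halves {a} {b} {y} a≤y b≤y eq = trans (≤-antisym a≤y (+-cancelʳ-≤ b y a (begin
  y + b   ≤⟨ +-monoʳ-≤ y b≤y ⟩
  y + y   ≡⟨ sym eq ⟩
  a + b   ∎))) (sym (≤-antisym b≤y (+-cancelˡ-≤ a y b (begin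
  a + y   ≤⟨ +-monoˡ-≤ y a≤y ⟩
  y + y   ≡⟨ sym eq ⟩
  a + b   ∎))))
  where open ≤-Reasoning

-- Raising `a` by 2 reduces this to `equal-halves`: both `suc (suc a)` and `b` are at most `suc z`,
-- and together they make twice that.
descent-tight : ∀ {a b z} → a < z → b ≤ suc z → a + b ≡ z + z → b ≡ suc (suc a)
descent-tight {a} {b} {suc z} (s≤s a≤z) b≤2+z eq = sym (equal-halves (s≤s (s≤s a≤z)) b≤2+z
  (trans (cong (λ x → suc (suc x)) eq) (double z)))
  where
  double : ∀ z → suc (suc (suc z + suc z)) ≡ suc (suc z) + suc (suc z)
  double = solve-∀

-- Periodic sequences

Periodic : ∀ {A : Set} → ℕ → (ℕ → A) → Set
Periodic k f = ∀ i → f (i + k) ≡ f i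

periodic-* : ∀ {A : Set} {k} {f : ℕ → A} → Periodic k f → ∀ i q → f (i + q * k) ≡ f i
periodic-* {f = f} p i zero    = cong f (+-identityʳ i)
periodic-* {k = k} {f} p i (suc q) =
  trans (cong f (trans (cong (i +_) (+-comm k (q * k))) (sym (+-assoc i (q * k) k))))
        (trans (p (i + q * k)) (periodic-* p i q))

periodic-% : ∀ {A : Set} {k} .{{_ : NonZero k}} {f : ℕ → A} → Periodic k f →
             ∀ i → f i ≡ f (i % k)
periodic-% {k = k} {f} p i =
  trans (cong f (m≡m%n+[m/n]*n i k)) (periodic-* p (i % k) (i / k))

suc-% : ∀ i k .{{_ : NonZero k}} →
        suc (i % k) < k × suc i % k ≡ suc (i % k) ⊎ suc (i % k) ≡ k × suc i % k ≡ 0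
suc-% i k = case m≤n⇒m<n∨m≡n (m%n<n i k) of λ where
    (inj₁ lt) → inj₁ (lt , trans reduce (m<n⇒m%n≡m lt))
    (inj₂ eq) → inj₂ (eq , trans reduce (trans (cong (_% k) eq) (n%n≡0 k)))
  where
  reduce : suc i % k ≡ suc (i % k) % k
  reduce = trans (cong (λ j → suc j % k) (m≡m%n+[m/n]*n i k)) ([m+kn]%n≡m%n (suc (i % k)) (i / k) k)

-- A finite graph is bipartite or has an odd cycle

module _ {n : ℕ} (_≈_ : Fin n → Fin n → Set) where

  -- The Boolean index is the parity of the number of edges.
  data Walk : Bool → Fin n → Fin n → Set where
    []  : ∀ {u} → Walk false u u
    _∷_ : ∀ {b u v w} → u ≈ v → Walk b v w → Walk (not b) u w

  -- A closed walk is unrolled into a periodic sequence, so that a change of starting point is a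
  -- mere shift of the index.
  record OddClosed (k : ℕ) : Set where
    field
      at       : ℕ → Fin n
      periodic : Periodic k at
      step     : ∀ i → at i ≈ at (suc i)
      isOdd    : odd k ≡ true

  Simple : ∀ {k} → OddClosed k → Set
  Simple {k} c = ∀ i d → suc d < k → at i ≢ at (i + suc d)
    where open OddClosed c

module _ {n : ℕ} {_≈_ : Fin n → Fin n → Set} where

  infixr 5 _++_
  _++_ : ∀ {b b′ u v w} → Walk _≈_ b u v → Walk _≈_ b′ v w → Walk _≈_ (b xor b′) u w
  _++_ []                q = q
  _++_ {b′ = b′} (_∷_ {b = b} e p) q =
    subst (λ x → Walk _≈_ x _ _) (Bool.not-distribˡ-xor b b′) (e ∷ p ++ q)

  toSequence : ∀ {b u v} → Walk _≈_ b u v →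
    ∃₂ λ k (h : ℕ → Fin n) → h 0 ≡ u × h k ≡ v × (∀ i → i < k → h i ≈ h (suc i)) × odd k ≡ b
  toSequence {u = u} [] = 0 , (λ _ → u) , refl , refl , (λ _ ()) , refl
  toSequence {u = u} (e ∷ p) with toSequence p
  ... | k , h , refl , hk , steps , par = suc k , h′ , refl , hk , steps′ , cong not par
    where
    h′ : ℕ → Fin n
    h′ zero    = u
    h′ (suc i) = h i
    steps′ : ∀ i → i < suc k → h′ i ≈ h′ (suc i)
    steps′ zero    _         = e
    steps′ (suc i) (s≤s i<k) = steps i i<k

  close : ∀ k (h : ℕ → Fin n) → (∀ i → i < k → h i ≈ h (suc i)) → h 0 ≡ h k →
          odd k ≡ true → OddClosed _≈_ k
  close k@(suc _) h steps h0≡hk isOdd = record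
    { at       = λ i → h (i % k)
    ; periodic = λ i → cong h ([m+n]%n≡m%n i k)
    ; step     = step
    ; isOdd    = isOdd
    }
    where
    step : ∀ i → h (i % k) ≈ h (suc i % k)
    step i with suc-% i k
    ... | inj₁ (_  , eq) = subst (h (i % k) ≈_) (cong h (sym eq)) (steps (i % k) (m%n<n i k))
    ... | inj₂ (k≡ , eq) = subst (h (i % k) ≈_)
            (trans (trans (cong h k≡) (sym h0≡hk)) (cong h (sym eq)))
            (steps (i % k) (m%n<n i k))

  -- A shortest odd closed walk is simple: a repeated vertex splits it into
  -- two closed walks, one of which is odd.
  simplify : ∀ k → OddClosed _≈_ k → ∃₂ λ k (c : OddClosed _≈_ k) → Simple _≈_ c
  simplify = <-rec _ go
    where
    go : ∀ k → (∀ {j} → j < k → OddClosed _≈_ j → ∃₂ λ k (c : OddClosed _≈_ k) → Simple _≈_ c) →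
         OddClosed _≈_ k → ∃₂ λ k (c : OddClosed _≈_ k) → Simple _≈_ c
    go (suc k′) rec c with anyUpTo? (λ i → anyUpTo? (λ d → at i ≟ at (i + suc d)) k′) (suc k′)
      where open OddClosed c
    ... | no none = suc k′ , c , λ { i d (s≤s d<k′) eq → none
        (i % suc k′ , m%n<n i (suc k′) , d , d<k′ ,
          trans (sym (periodic-% periodic i)) (trans eq (shifted i (suc d)))) }
      where
      open OddClosed c
      shifted : ∀ i e → at (i + e) ≡ at (i % suc k′ + e)
      shifted i e = trans (cong at eq)
        (periodic-* periodic (i % suc k′ + e) (i / suc k′))
        where
        eq : i + e ≡ i % suc k′ + e + i / suc k′ * suc k′
        eq = trans (cong (_+ e) (m≡m%n+[m/n]*n i (suc k′)))
          (trans (+-assoc (i % suc k′) _ e)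
          (trans (cong (i % suc k′ +_) (+-comm _ e)) (sym (+-assoc (i % suc k′) e _))))
    ... | yes (i , _ , d , d<k′ , eq) =
        case odd-summand (suc d) rest (trans (cong odd d+rest) isOdd) of λ where
          (inj₁ odd₁) → rec (s≤s d<k′)
            (close (suc d) (λ x → at (i + x))
              (λ x _ → subst (at (i + x) ≈_) (cong at (sym (+-suc i x))) (step (i + x)))
              (trans (cong at (+-identityʳ i)) eq) odd₁)
          (inj₂ odd₂) → rec (≤-trans (m<n+m rest (s≤s z≤n)) (≤-reflexive d+rest))
            (close rest (λ x → at (i + suc d + x))
              (λ x _ → subst (at (i + suc d + x) ≈_) (cong at (sym (+-suc (i + suc d) x))) (step _))
              (trans (cong at (+-identityʳ (i + suc d)))
                (trans (sym eq) (trans (sym (periodic i))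
                  (cong at (trans (cong (i +_) (sym d+rest)) (sym (+-assoc i (suc d) rest)))))))
              odd₂)
      where
      open OddClosed c
      rest : ℕ
      rest = suc k′ ∸ suc d
      d+rest : suc d + rest ≡ suc k′
      d+rest = m+[n∸m]≡n (s≤s (<⇒≤ d<k′))

  -- Union-find: ρ is constant on the components found so far, each of which
  -- is two-coloured by β.
  record PartialColouring (es : List (Fin n × Fin n)) : Set where
    field
      ρ      : Fin n → Fin n
      β      : Fin n → Bool
      joined : ∀ u v → ρ u ≡ ρ v → Walk _≈_ (β u xor β v) u v
      proper : All (λ (u , v) → ρ u ≡ ρ v × β u ≡ not (β v)) es

  emptyColouring : PartialColouring []
  emptyColouring = record
    { ρ = λ v → v ; β = λ _ → false ; joined = λ { u _ refl → [] } ; proper = [] }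

  -- Inside one component, an edge between equal colours closes a known walk of even length to an
  -- odd one. Between two components the edge merges them, after flipping the colours in the
  -- component of `v` if necessary.
  addEdge : Symmetric _≈_ → ∀ {es u v} → u ≈ v → PartialColouring es →
            PartialColouring ((u , v) ∷ es) ⊎ Walk _≈_ true u u
  addEdge ≈-sym {es} {u} {v} u≈v c with ρ u ≟ ρ v | β u Bool.≟ not (β v)
    where open PartialColouring c
  ... | yes ρu≡ρv | yes flip = inj₁ record
    { ρ = ρ ; β = β ; joined = joined ; proper = (ρu≡ρv , flip) ∷ proper }
    where open PartialColouring c
  ... | yes ρu≡ρv | no same = inj₂
    (u≈v ∷ subst (λ b → Walk _≈_ b v u) (equal (β u) (β v) same) (joined v u (sym ρu≡ρv)))
    where
    open PartialColouring c
    equal : ∀ a b → a ≢ not b → b xor a ≡ false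
    equal false false _ = refl
    equal false true  p = contradiction refl p
    equal true  false p = contradiction refl p
    equal true  true  _ = refl
  ... | no ρu≢ρv | _ = inj₁ record
    { ρ = ρ′ ; β = β′ ; joined = joined′ ; proper = newEdge ∷ All.map oldEdge proper }
    where
    open PartialColouring c
    -- True exactly when `u` and `v` have equal colours, so that the component of `v` must be
    -- flipped.
    s : Bool
    s = not (β u xor β v)
    ρ′ : Fin n → Fin n
    ρ′ x = if does (ρ x ≟ ρ v) then ρ u else ρ x
    β′ : Fin n → Bool
    β′ x = if does (ρ x ≟ ρ v) then β x xor s else β x

    -- In these three identities the left side is the parity of the walk, which crosses the new edge
    -- if only one end is moved; the right side comes from the new colours.
    bothMoved : ∀ a b s → a xor b ≡ (a xor s) xor (b xor s)
    bothMoved = solve 3 (λ a b s → a :+ b := (a :+ s) :+ (b :+ s)) refl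

    firstMoved : ∀ bx by bu bv →
      (bx xor bv) xor not (bu xor by) ≡ (bx xor not (bu xor bv)) xor by
    firstMoved = solve 4 (λ bx by bu bv →
      (bx :+ bv) :+ (con true :+ (bu :+ by)) := (bx :+ (con true :+ (bu :+ bv))) :+ by) refl

    secondMoved : ∀ bx by bu bv →
      (bx xor bu) xor not (bv xor by) ≡ bx xor (by xor not (bu xor bv))
    secondMoved = solve 4 (λ bx by bu bv →
      (bx :+ bu) :+ (con true :+ (bv :+ by)) := bx :+ (by :+ (con true :+ (bu :+ bv)))) refl

    joined′ : ∀ x y → ρ′ x ≡ ρ′ y → Walk _≈_ (β′ x xor β′ y) x y
    joined′ x y eq with ρ x ≟ ρ v | ρ y ≟ ρ v
    ... | yes ρx≡ | yes ρy≡ = subst (λ b → Walk _≈_ b x y) (bothMoved (β x) (β y) s)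
                                (joined x y (trans ρx≡ (sym ρy≡)))
    ... | yes ρx≡ | no  _   = subst (λ b → Walk _≈_ b x y) (firstMoved (β x) (β y) (β u) (β v))
                                (joined x v ρx≡ ++ ≈-sym u≈v ∷ joined u y eq)
    ... | no  _   | yes ρy≡ = subst (λ b → Walk _≈_ b x y) (secondMoved (β x) (β y) (β u) (β v))
                                (joined x u eq ++ u≈v ∷ joined v y (sym ρy≡))
    ... | no  _   | no  _   = joined x y eq

    oldEdge : ∀ {e} → ρ (proj₁ e) ≡ ρ (proj₂ e) × β (proj₁ e) ≡ not (β (proj₂ e)) →
              ρ′ (proj₁ e) ≡ ρ′ (proj₂ e) × β′ (proj₁ e) ≡ not (β′ (proj₂ e))
    oldEdge {x , y} (ρ≡ , β≡) with ρ x ≟ ρ v | ρ y ≟ ρ v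
    ... | yes _   | yes _   = refl , trans (cong (_xor s) β≡) (sym (Bool.not-distribˡ-xor (β y) s))
    ... | yes ρx≡ | no  ρy≢ = contradiction (trans (sym ρ≡) ρx≡) ρy≢
    ... | no  ρx≢ | yes ρy≡ = contradiction (trans ρ≡ ρy≡) ρx≢
    ... | no  _   | no  _   = ρ≡ , β≡

    flipped : ∀ a b → a ≡ not (b xor not (a xor b))
    flipped = solve 2 (λ a b → a := con true :+ (b :+ (con true :+ (a :+ b)))) refl

    newEdge : ρ′ u ≡ ρ′ v × β′ u ≡ not (β′ v)
    newEdge with ρ u ≟ ρ v | ρ v ≟ ρ v
    ... | yes ρ≡ | _     = contradiction ρ≡ ρu≢ρv
    ... | no  _  | yes _ = refl , flipped (β u) (β v)
    ... | no  _  | no ρ≢ = contradiction refl ρ≢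

  bipartite⊎oddCycle : Decidable _≈_ → Symmetric _≈_ →
    (∃ λ (β : Fin n → Bool) → ∀ {u v} → u ≈ v → β u ≢ β v) ⊎
    ∃₂ λ k (c : OddClosed _≈_ k) → Simple _≈_ c
  bipartite⊎oddCycle _≈?_ ≈-sym with colour edges (all-filter edge? pairs)
    where
    pairs : List (Fin n × Fin n)
    pairs = cartesianProduct (allFin n) (allFin n)
    edge? : ∀ ((u , v) : Fin n × Fin n) → Dec (u ≈ v)
    edge? (u , v) = u ≈? v
    edges : List (Fin n × Fin n)
    edges = filter edge? pairs
    colour : ∀ es → All (uncurry _≈_) es → PartialColouring es ⊎ ∃ λ u → Walk _≈_ true u u
    colour []       []        = inj₁ emptyColouring
    colour (e ∷ es) (p ∷ ps) with colour es ps
    ... | inj₂ w = inj₂ w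
    ... | inj₁ c with addEdge ≈-sym p c
    ...   | inj₁ c′ = inj₁ c′
    ...   | inj₂ w  = inj₂ (_ , w)
  ... | inj₁ c = inj₁ (β , λ {u} {v} u≈v βu≡βv → Bool.not-¬ refl (trans (sym βu≡βv)
        (proj₂ (All.lookup proper (∈-filter⁺ (λ (u , v) → u ≈? v)
          (∈-cartesianProduct⁺ (∈-allFin u) (∈-allFin v)) u≈v)))))
    where open PartialColouring c
  ... | inj₂ (u , w) with toSequence w
  ...   | k , h , h0 , hk , steps , par = inj₂ (simplify k (close k h steps (trans h0 (sym hk)) par))

-- Partial two-colourings of a finite set; nothing marks an uncoloured vertex

Colouring : ℕ → Set
Colouring n = Fin n → Maybe Bool

weigh : Maybe Bool → ℕ → ℕ
weigh nothing  w = w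
weigh (just _) w = 0

module _ {n : ℕ} where

  infix 5 _[_≔_]
  _[_≔_] : Colouring n → Fin n → Maybe Bool → Colouring n
  c [ v ≔ x ] = updateAt c v (const x)

  -- Weights 1 count the uncoloured vertices; the weights `d` add up their distances to the roots.
  cost : (Fin n → ℕ) → Colouring n → ℕ
  cost wt c = sum λ v → weigh (c v) (wt v)

  cost-cong : ∀ wt {c c′} → c ≗ c′ → cost wt c ≡ cost wt c′
  cost-cong wt c≗c′ = sum-cong-≗ λ v → cong (λ x → weigh x (wt v)) (c≗c′ v)

-- Cross-addition expresses the change at one index without subtraction.
sum-exchange : ∀ {n} (f g : Fin n → ℕ) i → (∀ j → j ≢ i → f j ≡ g j) →
               sum f + g i ≡ sum g + f i
sum-exchange {suc n} f g i agree = begin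
  sum f + g i                       ≡⟨ cong (_+ g i) (sum-remove {i = i} f) ⟩
  f i + sum (removeAt f i) + g i    ≡⟨ cong (λ s → f i + s + g i) (sum-cong-≗ λ j → agree (punchIn i j) (punchInᵢ≢i i j)) ⟩
  f i + sum (removeAt g i) + g i    ≡⟨ +-comm (f i + _) (g i) ⟩
  g i + (f i + sum (removeAt g i))  ≡⟨ cong (g i +_) (+-comm (f i) _) ⟩
  g i + (sum (removeAt g i) + f i)  ≡⟨ sym (+-assoc (g i) _ (f i)) ⟩
  g i + sum (removeAt g i) + f i    ≡⟨ cong (_+ f i) (sym (sum-remove {i = i} g)) ⟩
  sum g + f i                       ∎
  where open ≡-Reasoning

module _ {n : ℕ} where

  cost-update : ∀ wt (c : Colouring n) v x →
    cost wt (c [ v ≔ x ]) + weigh (c v) (wt v) ≡ cost wt c + weigh x (wt v)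
  cost-update wt c v x = trans
    (sum-exchange (λ u → weigh ((c [ v ≔ x ]) u) (wt u)) (λ u → weigh (c u) (wt u)) v
      λ u u≢v → cong (λ y → weigh y (wt u)) (updateAt-minimal u v c u≢v))
    (cong (λ y → cost wt c + weigh y (wt v)) (updateAt-updates v c))

  cost-colour : ∀ wt (c : Colouring n) v b → c v ≡ nothing →
                cost wt (c [ v ≔ just b ]) + wt v ≡ cost wt c
  cost-colour wt c v b cv = trans
    (subst (λ x → cost wt (c [ v ≔ just b ]) + weigh x (wt v) ≡ cost wt c + 0) cv
      (cost-update wt c v (just b)))
    (+-identityʳ _)

  cost-uncolour : ∀ wt (c : Colouring n) {v b} → c v ≡ just b →
                  cost wt (c [ v ≔ nothing ]) ≡ cost wt c + wt v
  cost-uncolour wt c {v} cv = trans (sym (+-identityʳ _))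
    (subst (λ x → cost wt (c [ v ≔ nothing ]) + weigh x (wt v) ≡ cost wt c + wt v) cv
      (cost-update wt c v nothing))

  wt≤cost : ∀ wt (c : Colouring n) v → c v ≡ nothing → wt v ≤ cost wt c
  wt≤cost wt c v cv = ≤-trans (m≤n+m (wt v) _) (≤-reflexive (cost-colour wt c v false cv))

  private
    toFin : Maybe Bool → Fin 3
    toFin nothing      = zero
    toFin (just false) = suc zero
    toFin (just true)  = suc (suc zero)

    fromFin : Fin 3 → Maybe Bool
    fromFin zero          = nothing
    fromFin (suc zero)    = just false
    fromFin (suc (suc _)) = just true

    fromFin-toFin : ∀ x → fromFin (toFin x) ≡ x
    fromFin-toFin nothing      = refl
    fromFin-toFin (just false) = refl
    fromFin-toFin (just true)  = refl

    decode : Fin (3 ^ n) → Colouring n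
    decode k = fromFin ∘ finToFun k

    decode-encode : ∀ c → decode (funToFin (toFin ∘ c)) ≗ c
    decode-encode c v = trans (cong fromFin (finToFun-funToFin (toFin ∘ c) v)) (fromFin-toFin (c v))

  -- Colourings are functions, so the search runs over codes in `Fin (3 ^ n)`. Decoding recovers a
  -- colouring only pointwise, whence the assumption that `P` respects `≗`.
  minimise : {P : Colouring n → Set} → (∀ c → Dec (P c)) → (∀ {c c′} → c ≗ c′ → P c → P c′) →
             ∀ wt → ∃ P → ∃ λ c → P c × (∀ c′ → P c′ → cost wt c ≤ cost wt c′)
  minimise {P} P? resp wt (c₀ , p₀) = <-rec Goal descend _ c₀ refl p₀
    where
    Goal : ℕ → Set
    Goal m = ∀ c → cost wt c ≡ m → P c → ∃ λ c → P c × (∀ c′ → P c′ → cost wt c ≤ cost wt c′)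
    descend : ∀ m → (∀ {j} → j < m → Goal j) → Goal m
    descend m rec c refl p with any? (λ k → P? (decode k) ×-dec (cost wt (decode k) ℕ.<? cost wt c))
    ... | yes (k , pk , lt) = rec lt (decode k) refl pk
    ... | no  none = c , p , λ c′ p′ → ≮⇒≥ λ lt → none
      ( funToFin (toFin ∘ c′)
      , resp (sym ∘ decode-encode c′) p′
      , subst (_< cost wt c) (cost-cong wt (sym ∘ decode-encode c′)) lt )

cost-mono-≤ : ∀ {n} wt wt′ (c : Colouring n) → (∀ v → c v ≡ nothing → wt v ≤ wt′ v) → cost wt c ≤ cost wt′ c
cost-mono-≤ {zero}  wt wt′ c le = z≤n
cost-mono-≤ {suc n} wt wt′ c le = +-mono-≤ (first (c zero) refl)
  (cost-mono-≤ (wt ∘ suc) (wt′ ∘ suc) (c ∘ suc) λ v → le (suc v))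
  where
  first : ∀ x → c zero ≡ x → weigh x (wt zero) ≤ weigh x (wt′ zero)
  first nothing  eq = le zero eq
  first (just _) eq = z≤n

-- Proper partial colourings, scattered sets and distances to roots

module PartialColourings (G : Graph) where
  open Graph G

  Proper : Colouring order → Set
  Proper c = ∀ u v → u ~ v → ∀ b → c u ≡ just b → c v ≢ just b

  proper? : ∀ c → Dec (Proper c)
  proper? c = all? λ u → all? λ v → (u ~? v) →-dec
    map′ (λ { (f , t) false → f ; (f , t) true → t }) (λ h → h false , h true)
      (bichromatic? u v false ×-dec bichromatic? u v true)
    where
    bichromatic? : ∀ u v b → Dec (c u ≡ just b → c v ≢ just b)
    bichromatic? u v b = Maybe.≡-dec Bool._≟_ (c u) (just b) →-dec ¬? (Maybe.≡-dec Bool._≟_ (c v) (just b))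

  proper-resp : ∀ {c c′} → c ≗ c′ → Proper c → Proper c′
  proper-resp c≗c′ p u v e b cu cv = p u v e b (trans (c≗c′ u) cu) (trans (c≗c′ v) cv)

  proper-uncolour : ∀ {c} w → Proper c → Proper (c [ w ≔ nothing ])
  proper-uncolour {c} w p u v e b cu cv with u ≟ w | v ≟ w
  ... | yes refl | _        = contradiction (trans (sym (updateAt-updates u c)) cu) λ()
  ... | no _     | yes refl = contradiction (trans (sym (updateAt-updates v c)) cv) λ()
  ... | no u≢w   | no v≢w   = p u v e b (trans (sym (updateAt-minimal u w c u≢w)) cu)
                                        (trans (sym (updateAt-minimal v w c v≢w)) cv)

  proper-colour : ∀ {c} v b → Proper c → (∀ w → v ~ w → c w ≢ just b) → Proper (c [ v ≔ just b ])
  proper-colour {c} v b p free x y e b′ cx cy with x ≟ v | y ≟ v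
  ... | yes refl | yes refl = ~-irrefl e
  ... | yes refl | no y≢v   = free y e
        (trans (sym (updateAt-minimal y v c y≢v)) (trans cy (trans (sym cx) (updateAt-updates x c))))
  ... | no x≢v   | yes refl = free x (~-sym e)
        (trans (sym (updateAt-minimal x v c x≢v)) (trans cx (trans (sym cy) (updateAt-updates y c))))
  ... | no x≢v   | no y≢v   = p x y e b′ (trans (sym (updateAt-minimal x v c x≢v)) cx)
                                         (trans (sym (updateAt-minimal y v c y≢v)) cy)

  -- Lazy walks: Within m u v says that the distance is at most m.
  Within : ℕ → Vertex → Vertex → Set
  Within zero    u v = u ≡ v
  Within (suc m) u v = Within m u v ⊎ ∃ λ x → u ~ x × Within m x v

  within? : ∀ m u v → Dec (Within m u v)
  within? zero    u v = u ≟ v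
  within? (suc m) u v = within? m u v ⊎-dec any? λ x → (u ~? x) ×-dec within? m x v

  within-snoc : ∀ m {u v w} → Within m u v → v ~ w → Within (suc m) u w
  within-snoc zero    refl             e = inj₂ (_ , e , refl)
  within-snoc (suc m) (inj₁ p)         e = inj₁ (within-snoc m p e)
  within-snoc (suc m) (inj₂ (x , f , p)) e = inj₂ (x , f , within-snoc m p e)

  within-sym : ∀ m {u v} → Within m u v → Within m v u
  within-sym zero    refl               = refl
  within-sym (suc m) (inj₁ p)           = inj₁ (within-sym m p)
  within-sym (suc m) (inj₂ (x , e , p)) = within-snoc m (within-sym m p) (~-sym e)

  within-refl : ∀ m {u} → Within m u u
  within-refl zero    = refl
  within-refl (suc m) = inj₁ (within-refl m)

  within-mono : ∀ {m n u v} → m ≤ n → Within m u v → Within n u v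
  within-mono {m} {n} {u} {v} m≤n p = subst (λ k → Within k u v) (m∸n+n≡m m≤n) (lift (n ∸ m))
    where
    lift : ∀ d → Within (d + m) u v
    lift zero    = p
    lift (suc d) = inj₁ (lift d)

  -- Greedy choice: a vertex is rejected only if a kept one is within 3, so the kept vertices are
  -- both far apart and dominating.
  scattered : List Vertex → List Vertex
  scattered [] = []
  scattered (x ∷ xs) with Any.any? (within? 3 x) (scattered xs)
  ... | yes _ = scattered xs
  ... | no  _ = x ∷ scattered xs

  scattered-⊆ : ∀ xs {v} → v ∈ scattered xs → v ∈ xs
  scattered-⊆ (x ∷ xs) v∈ with Any.any? (within? 3 x) (scattered xs)
  scattered-⊆ (x ∷ xs) v∈          | yes _ = there (scattered-⊆ xs v∈)
  scattered-⊆ (x ∷ xs) (here refl) | no  _ = here refl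
  scattered-⊆ (x ∷ xs) (there v∈)  | no  _ = there (scattered-⊆ xs v∈)

  scattered-far : ∀ xs {u v} → u ∈ scattered xs → v ∈ scattered xs → u ≢ v → ¬ Within 3 u v
  scattered-far (x ∷ xs) u∈ v∈ u≢v p with Any.any? (within? 3 x) (scattered xs)
  scattered-far (x ∷ xs) u∈ v∈ u≢v p                   | yes _ = scattered-far xs u∈ v∈ u≢v p
  scattered-far (x ∷ xs) (here refl) (here refl) u≢v p | no ¬a = u≢v refl
  scattered-far (x ∷ xs) (here refl) (there v∈)  u≢v p | no ¬a = ¬a (Any.map (λ { refl → p }) v∈)
  scattered-far (x ∷ xs) (there u∈)  (here refl) u≢v p | no ¬a =
    ¬a (Any.map (λ { refl → within-sym 3 p }) u∈)
  scattered-far (x ∷ xs) (there u∈)  (there v∈)  u≢v p | no ¬a = scattered-far xs u∈ v∈ u≢v p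

  scattered-dominates : ∀ xs {v} → v ∈ xs → Any (Within 3 v) (scattered xs)
  scattered-dominates (x ∷ xs) v∈ with Any.any? (within? 3 x) (scattered xs)
  scattered-dominates (x ∷ xs) (here refl) | yes a = a
  scattered-dominates (x ∷ xs) (there v∈)  | yes _ = scattered-dominates xs v∈
  scattered-dominates (x ∷ xs) (here refl) | no  _ = here (within-refl 3)
  scattered-dominates (x ∷ xs) (there v∈)  | no  _ = there (scattered-dominates xs v∈)

  -- The distance to a set of roots, truncated at N.
  module Distance (roots : List Vertex) where

    near? : ∀ m v → Dec (Any (Within m v) roots)
    near? m v = Any.any? (within? m v) roots

    δ : ℕ → Vertex → ℕ
    δ zero    v = 0
    δ (suc N) v with near? N v
    ... | yes _ = δ N v
    ... | no  _ = suc N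

    near-mono : ∀ {m n v} → m ≤ n → Any (Within m v) roots → Any (Within n v) roots
    near-mono m≤n = Any.map (within-mono m≤n)

    near-step : ∀ {m u v} → u ~ v → Any (Within m v) roots → Any (Within (suc m) u) roots
    near-step e = Any.map λ p → inj₂ (_ , e , p)

    δ≤N : ∀ N v → δ N v ≤ N
    δ≤N zero    v = z≤n
    δ≤N (suc N) v with near? N v
    ... | yes _ = m≤n⇒m≤1+n (δ≤N N v)
    ... | no  _ = ≤-refl

    near⇒δ≤ : ∀ N {m v} → Any (Within m v) roots → δ N v ≤ m
    near⇒δ≤ zero    a = z≤n
    near⇒δ≤ (suc N) {m} {v} a with near? N v
    ... | yes _ = near⇒δ≤ N a
    ... | no ¬a = ≰⇒> λ m≤N → ¬a (near-mono m≤N a)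

    δ<⇒near : ∀ N v → δ N v < N → Any (Within (δ N v) v) roots
    δ<⇒near (suc N) v lt with near? N v
    ... | no  _ = contradiction lt (<-irrefl refl)
    ... | yes a with m≤n⇒m<n∨m≡n (δ≤N N v)
    ...   | inj₁ δ<N = δ<⇒near N v δ<N
    ...   | inj₂ δ≡N = subst (λ k → Any (Within k v) roots) (sym δ≡N) a

    δ-lipschitz : ∀ N {u v} → u ~ v → δ N u ≤ suc (δ N v)
    δ-lipschitz N {u} {v} e with m≤n⇒m<n∨m≡n (δ≤N N v)
    ... | inj₁ δ<N = near⇒δ≤ N (near-step e (δ<⇒near N v δ<N))
    ... | inj₂ δ≡N = ≤-trans (δ≤N N u) (≤-trans (≤-reflexive (sym δ≡N)) (n≤1+n _))

    -- A value below the truncation is a genuine distance, so the first edge of a shortest walk to a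
    -- root leads closer; there is such an edge because `v` is not a root.
    δ-descend : ∀ N {v} → δ N v < N → ¬ v ∈ roots → ∃ λ p → v ~ p × δ N p < δ N v
    δ-descend N {v} lt v∉ with δ N v in eq | δ<⇒near N v lt
    ... | zero  | a = contradiction a v∉
    ... | suc k | a with find a
    ...   | _ , r∈ , inj₁ p           =
      contradiction (≤-trans (≤-reflexive (sym eq)) (near⇒δ≤ N (lose r∈ p))) (<-irrefl refl)
    ...   | _ , r∈ , inj₂ (x , e , p) = x , e , s≤s (near⇒δ≤ N (lose r∈ p))

just≢nothing : ∀ {A : Set} {x : Maybe A} {a} → x ≡ just a → x ≢ nothing
just≢nothing refl ()

different-colours : ∀ {n} (c : Colouring n) {u v b} → c u ≡ just b → c v ≡ just (not b) → u ≢ v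
different-colours c cu cv refl = Bool.not-¬ refl (just-injective (trans (sym cu) cv))

-- Colourings of a subcubic graph with fewest uncoloured vertices

module SubcubicGraph (G : Graph) (subcubic : Subcubic G) where
  open Graph G
  open PartialColourings G

  -- Pigeonhole: four neighbours occupy at most three positions in the list of neighbours, and `a`,
  -- `b`, `c` do not collide with each other.
  fourth-neighbour : ∀ {v a b c d} → v ~ a → v ~ b → v ~ c → v ~ d →
                     a ≢ b → a ≢ c → b ≢ c → d ≡ a ⊎ d ≡ b ⊎ d ≡ c
  fourth-neighbour {v} {a} {b} {c} {d} ea eb ec ed a≢b a≢c b≢c
    = let i , j , i<j , eq = pigeonhole (s≤s (subcubic v)) (Any.index ∘ listed)
      in cases i j i<j (trans (lookup-index (listed i))
           (trans (cong (List.lookup nbrs) eq) (sym (lookup-index (listed j)))))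
    where
    nbrs : List Vertex
    nbrs = filter (v ~?_) (allFin order)
    nbr : Fin 4 → ∃ (v ~_)
    nbr zero                   = a , ea
    nbr (suc zero)             = b , eb
    nbr (suc (suc zero))       = c , ec
    nbr (suc (suc (suc zero))) = d , ed
    listed : ∀ i → proj₁ (nbr i) ∈ nbrs
    listed i = ∈-filter⁺ (v ~?_) (∈-allFin (proj₁ (nbr i))) (proj₂ (nbr i))
    cases : ∀ i j → i Fin.< j → proj₁ (nbr i) ≡ proj₁ (nbr j) → d ≡ a ⊎ d ≡ b ⊎ d ≡ c
    cases zero zero () eq
    cases zero (suc zero) _ eq = contradiction eq a≢b
    cases zero (suc (suc zero)) _ eq = contradiction eq a≢c
    cases zero (suc (suc (suc zero))) _ eq = inj₁ (sym eq)
    cases (suc zero) (suc zero) (s≤s ()) eq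
    cases (suc zero) (suc (suc zero)) _ eq = contradiction eq b≢c
    cases (suc zero) (suc (suc (suc zero))) _ eq = inj₂ (inj₁ (sym eq))
    cases (suc (suc zero)) (suc zero) (s≤s ()) eq
    cases (suc (suc zero)) (suc (suc zero)) (s≤s (s≤s ())) eq
    cases (suc (suc zero)) (suc (suc (suc zero))) _ eq = inj₂ (inj₂ (sym eq))
    cases (suc (suc (suc zero))) (suc zero) (s≤s ()) eq
    cases (suc (suc (suc zero))) (suc (suc zero)) (s≤s (s≤s ())) eq
    cases (suc (suc (suc zero))) (suc (suc (suc zero))) (s≤s (s≤s (s≤s ()))) eq

  card : Colouring order → ℕ
  card = cost (const 1)

  CardMin : Colouring order → Set
  CardMin c = Proper c × (∀ c′ → Proper c′ → card c ≤ card c′)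

  cardMin-transfer : ∀ {c c′} → CardMin c → Proper c′ → card c′ ≡ card c → CardMin c′
  cardMin-transfer (_ , min) p′ eq = p′ , λ c″ p″ → ≤-trans (≤-reflexive eq) (min c″ p″)

  -- Otherwise v itself could be coloured.
  both-colours : ∀ {c v} → CardMin c → c v ≡ nothing → ∀ b → ∃ λ w → v ~ w × c w ≡ just b
  both-colours {c} {v} (p , min) cv b with any? (λ w → (v ~? w) ×-dec Maybe.≡-dec Bool._≟_ (c w) (just b))
  ... | yes found = found
  ... | no  none  = contradiction
    (min (c [ v ≔ just b ]) (proper-colour v b p λ w e cw → none (w , e , cw)))
    (<⇒≱ (≤-reflexive (trans (+-comm 1 _) (cost-colour (const 1) c v b cv))))

  Only : Colouring order → Vertex → Bool → Vertex → Set
  Only c v b w = ∀ x → v ~ x → c x ≡ just b → x ≡ w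

  -- By `both-colours`, two of the at most three neighbours of `v` are coloured.
  blank-unique : ∀ {c v z z′} → CardMin c → c v ≡ nothing →
                 v ~ z → c z ≡ nothing → v ~ z′ → c z′ ≡ nothing → z ≡ z′
  blank-unique {c} {v} min cv ez cz ez′ cz′ =
    let p , ep , cp = both-colours min cv true
        q , eq , cq = both-colours min cv false
    in case fourth-neighbour ep eq ez ez′ (different-colours c cp cq)
              (λ { refl → just≢nothing cp cz }) (λ { refl → just≢nothing cq cz }) of λ where
         (inj₁ refl)        → contradiction cz′ (just≢nothing cp)
         (inj₂ (inj₁ refl)) → contradiction cz′ (just≢nothing cq)
         (inj₂ (inj₂ z′≡z)) → sym z′≡z

  -- By `both-colours` and the degree bound, the neighbours of `v` are `z` and exactly one of each
  -- colour.
  blank⇒only : ∀ {c v z w b} → CardMin c → c v ≡ nothing → v ~ z → c z ≡ nothing →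
               v ~ w → c w ≡ just b → Only c v b w
  blank⇒only {c} {b = b} min cv ez cz ew cw x ex cx =
    let p , ep , cp = both-colours min cv (not b)
    in case fourth-neighbour ew ep ez ex (different-colours c cw cp)
              (λ { refl → just≢nothing cw cz }) (λ { refl → just≢nothing cp cz }) of λ where
         (inj₁ x≡w)         → x≡w
         (inj₂ (inj₁ refl)) → contradiction refl (different-colours c cx cp)
         (inj₂ (inj₂ refl)) → contradiction cz (just≢nothing cx)

  -- Moves the uncoloured place from `v` to `w`, where `b` is meant to be the colour of `w`.
  slide : Colouring order → Vertex → Bool → Vertex → Colouring order
  slide c v b w = (c [ w ≔ nothing ]) [ v ≔ just b ]

  module _ {c : Colouring order} {v w : Vertex} {b : Bool} where

    slide-blank : w ≢ v → slide c v b w w ≡ nothing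
    slide-blank w≢v = trans (updateAt-minimal w v _ w≢v) (updateAt-updates w c)

    slide-other : ∀ {x} → x ≢ v → x ≢ w → slide c v b w x ≡ c x
    slide-other x≢v x≢w = trans (updateAt-minimal _ v _ x≢v) (updateAt-minimal _ w c x≢w)

    slide-proper : Proper c → Only c v b w → Proper (slide c v b w)
    slide-proper p only = proper-colour v b (proper-uncolour w p) free
      where
      free : ∀ x → v ~ x → (c [ w ≔ nothing ]) x ≢ just b
      free x e cx with x ≟ w
      ... | yes refl = just≢nothing cx (updateAt-updates w c)
      ... | no  x≢w  = x≢w (only x e (trans (sym (updateAt-minimal x w c x≢w)) cx))

    slide-cost : ∀ {b′} → c v ≡ nothing → c w ≡ just b′ → ∀ wt →
                 cost wt (slide c v b w) + wt v ≡ cost wt c + wt w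
    slide-cost cv cw wt = trans
      (cost-colour wt (c [ w ≔ nothing ]) v b
        (trans (updateAt-minimal v w c λ { refl → just≢nothing cw cv }) cv))
      (cost-uncolour wt c cw)

  -- Optimal colourings and their tokens

  module Tokens (roots : List Vertex) (N : ℕ) where
    open Distance roots

    d : Vertex → ℕ
    d = δ N

    Rooted : Colouring order → Set
    Rooted c = ∀ {r} → r ∈ roots → c r ≡ nothing

    record Optimal (c : Colouring order) : Set where
      field
        cardMin : CardMin c
        rooted  : Rooted c
        least   : ∀ {c′} → CardMin c′ → Rooted c′ → cost d c ≤ cost d c′
        -- Keeps `d` strictly below `N` at every uncoloured vertex, so that these distances are not
        -- truncated.
        small   : cost d c < N

    open Optimal

    Token : Colouring order → Vertex → Set
    Token c v = c v ≡ nothing × v ∉ roots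

    optimal-transfer : ∀ {c c′} → Optimal c → CardMin c′ → Rooted c′ → cost d c′ ≤ cost d c → Optimal c′
    optimal-transfer opt min rt le = record
      { cardMin = min
      ; rooted  = rt
      ; least   = λ min′ rt′ → ≤-trans le (least opt min′ rt′)
      ; small   = ≤-<-trans le (small opt)
      }

    slide-cardMin : ∀ {c v b w b′} → CardMin c → c v ≡ nothing → c w ≡ just b′ → Only c v b w →
                    CardMin (slide c v b w)
    slide-cardMin {c} min cv cw only = cardMin-transfer min (slide-proper (proj₁ min) only)
      (+-cancelʳ-≡ 1 _ _ (slide-cost cv cw (const 1)))

    slide-rooted : ∀ {c v b w b′} → Rooted c → v ∉ roots → c w ≡ just b′ → Rooted (slide c v b w)
    slide-rooted {c} {v} {w = w} rt v∉ cw {r} r∈ with r ≟ w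
    ... | yes refl = contradiction (rt r∈) (just≢nothing cw)
    ... | no  r≢w  = trans (slide-other {c} (λ { refl → v∉ r∈ }) r≢w) (rt r∈)

    -- The slide from `v` to `w` changes the cost by `d w` minus `d v`, which optimality forbids to
    -- be negative.
    only⇒δ≤ : ∀ {c v w b} → Optimal c → Token c v → c w ≡ just b → Only c v b w → d v ≤ d w
    only⇒δ≤ {c} {v} {w} {b} opt (cv , v∉) cw only = +-cancelˡ-≤ (cost d c) _ _ (begin
      cost d c + d v                 ≤⟨ +-monoˡ-≤ (d v) (least opt (slide-cardMin (cardMin opt) cv cw only)
                                          (slide-rooted (rooted opt) v∉ cw)) ⟩
      cost d (slide c v b w) + d v   ≡⟨ slide-cost cv cw d ⟩
      cost d c + d w                 ∎)
      where open ≤-Reasoning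

    parent : ∀ {c v} → Optimal c → Token c v → ∃ λ p → v ~ p × d p < d v
    parent {c} {v} opt (cv , v∉) = δ-descend N (≤-<-trans (wt≤cost d c v cv) (small opt)) v∉

    -- Next to the uncoloured `v`, every coloured neighbour of `u` is the only one of its colour,
    -- hence not closer to the roots. So the closer neighbour given by `parent` is `v`.
    parent-of-adjacent : ∀ {c u v} → Optimal c → Token c u → Token c v → u ~ v → d v < d u
    parent-of-adjacent {c} {u} {v} opt tu@(cu , _) (cv , _) e with parent opt tu
    ... | p , ep , lt with c p in cp
    ...   | nothing = subst (λ x → d x < d u) (blank-unique (cardMin opt) cu ep cp e cv) lt
    ...   | just b  = contradiction lt
            (≤⇒≯ (only⇒δ≤ opt tu cp (blank⇒only (cardMin opt) cu e cv ep cp)))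

    tokens-independent : ∀ {c u v} → Optimal c → Token c u → Token c v → ¬ u ~ v
    tokens-independent opt tu tv e =
      <-asym (parent-of-adjacent opt tu tv e) (parent-of-adjacent opt tv tu (~-sym e))

    module _ {c : Colouring order} {w : Vertex} {b : Bool} (opt : Optimal c) (cw : c w ≡ just b) where

      -- With three uncoloured neighbours w is free to take either colour, so
      -- the other neighbours of u block both of them.
      isolated⇒child : (∀ {x} → w ~ x → c x ≡ nothing) → ∀ {u} → w ~ u → Token c u → d w < d u
      isolated⇒child isolated {u} e tu@(cu , u∉) =
        go (both-colours (cardMin opt′) cu′ b) (both-colours (cardMin opt) cu (not b)) (parent opt tu)
        where
        c′ : Colouring order
        c′ = c [ w ≔ just (not b) ]
        c′w : c′ w ≡ just (not b)
        c′w = updateAt-updates w c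
        cost-c′ : ∀ wt → cost wt c′ ≡ cost wt c
        cost-c′ wt = +-cancelʳ-≡ 0 _ _
          (subst (λ x → cost wt c′ + weigh x (wt w) ≡ cost wt c + 0) cw (cost-update wt c w (just (not b))))
        opt′ : Optimal c′
        opt′ = optimal-transfer opt
          (cardMin-transfer (cardMin opt)
            (proper-colour w (not b) (proj₁ (cardMin opt)) λ x e cx → just≢nothing cx (isolated e))
            (cost-c′ (const 1)))
          (λ r∈ → trans (updateAt-minimal _ w c λ { refl → just≢nothing cw (rooted opt r∈) }) (rooted opt r∈))
          (≤-reflexive (cost-c′ d))
        cu′ : c′ u ≡ nothing
        cu′ = trans (updateAt-minimal u w c λ { refl → ~-irrefl e }) cu

        go : (∃ λ x → u ~ x × c′ x ≡ just b) → (∃ λ y → u ~ y × c y ≡ just (not b)) →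
             (∃ λ p → u ~ p × d p < d u) → d w < d u
        -- After recolouring `w`, `x` is the only neighbour of `u` with its colour; before it, `y`
        -- is. Neither is closer than `u`, so the parent is `w`.
        go (x , ex , cx) (y , ey , cy) (p , ep , lt) = case neighbour ep of λ where
            (inj₁ refl)        → lt
            (inj₂ (inj₁ refl)) → contradiction lt (≤⇒≯ (only⇒δ≤ opt′ (cu′ , u∉) cx onlyX))
            (inj₂ (inj₂ refl)) → contradiction lt (≤⇒≯ (only⇒δ≤ opt tu cy onlyY))
          where
          w≢x : w ≢ x
          w≢x w≡x = different-colours c′ cx c′w (sym w≡x)
          w≢y : w ≢ y
          w≢y = different-colours c cw cy
          cx₀ : c x ≡ just b
          cx₀ = trans (sym (updateAt-minimal x w c (w≢x ∘ sym))) cx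
          neighbour : ∀ {z} → u ~ z → z ≡ w ⊎ z ≡ x ⊎ z ≡ y
          neighbour ez = fourth-neighbour (~-sym e) ex ey ez w≢x w≢y (different-colours c cx₀ cy)
          onlyX : Only c′ u b x
          onlyX z ez cz = case neighbour ez of λ where
            (inj₁ refl)        → contradiction refl (different-colours c′ cz c′w)
            (inj₂ (inj₁ z≡x))  → z≡x
            (inj₂ (inj₂ refl)) → contradiction refl
              (different-colours c (trans (sym (updateAt-minimal z w c (w≢y ∘ sym))) cz) cy)
          onlyY : Only c u (not b) y
          onlyY z ez cz = case neighbour ez of λ where
            (inj₁ refl)        → contradiction refl (different-colours c cw cz)
            (inj₂ (inj₁ refl)) → contradiction refl (different-colours c cx₀ cz)
            (inj₂ (inj₂ z≡y))  → z≡y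

      -- Three token neighbours are all farther from the roots than `w`, by `isolated⇒child`; but
      -- `w`, being coloured, is not a root and must have a closer neighbour.
      at-most-two-tokens : ∀ {u₁ u₂ u₃} → w ~ u₁ → w ~ u₂ → w ~ u₃ →
        Token c u₁ → Token c u₂ → Token c u₃ → u₁ ≢ u₂ → u₁ ≢ u₃ → u₂ ≢ u₃ → ⊥
      at-most-two-tokens {u₁} {u₂} {u₃} e₁ e₂ e₃ t₁ t₂ t₃ u₁≢u₂ u₁≢u₃ u₂≢u₃ =
        let p , ep , lt = δ-descend N (<-trans (child e₁ t₁) (≤-<-trans (wt≤cost d c _ (proj₁ t₁)) (small opt)))
                            (λ w∈ → just≢nothing cw (rooted opt w∈))
        in impossible ep lt
        where
        neighbour : ∀ {x} → w ~ x → x ≡ u₁ ⊎ x ≡ u₂ ⊎ x ≡ u₃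
        neighbour e = fourth-neighbour e₁ e₂ e₃ e u₁≢u₂ u₁≢u₃ u₂≢u₃
        isolated : ∀ {x} → w ~ x → c x ≡ nothing
        isolated e with neighbour e
        ... | inj₁ refl        = proj₁ t₁
        ... | inj₂ (inj₁ refl) = proj₁ t₂
        ... | inj₂ (inj₂ refl) = proj₁ t₃
        child : ∀ {u} → w ~ u → Token c u → d w < d u
        child = isolated⇒child isolated
        impossible : ∀ {p} → w ~ p → ¬ d p < d w
        impossible ep lt with neighbour ep
        ... | inj₁ refl        = <-asym lt (child e₁ t₁)
        ... | inj₂ (inj₁ refl) = <-asym lt (child e₂ t₂)
        ... | inj₂ (inj₂ refl) = <-asym lt (child e₃ t₃)

  -- The bounds K and L differ when a whole cycle is slid: its last w is then
  -- uncoloured beforehand.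
  module Slides (c : Colouring order) (K L : ℕ) (v w : ℕ → Vertex) (κ : ℕ → Bool) where

    -- The result of sliding v j to w (suc j) for all j < m.
    record Slid (m : ℕ) : Set where
      field
        now       : Colouring order
        nowProper : Proper now
        -- Valid for all weights at once: weights 1 show that the number of uncoloured vertices is
        -- kept, the weights `d` compare distances.
        balance   : ∀ wt → cost wt now + sumTo m (λ j → wt (v j)) ≡ cost wt c + sumTo m (λ j → wt (w (suc j)))
        pending   : ∀ {j} → m ≤ j → j < K → now (v j) ≡ nothing
        intact    : ∀ {j} → m ≤ j → j < L → now (w (suc j)) ≡ just (κ (suc j))
        vacated   : ∀ {j} → j < m → now (w (suc j)) ≡ nothing
        kept      : ∀ {u b} → c u ≡ just b → now u ≡ just b ⊎ now u ≡ nothing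
        fresh     : ∀ {u} → c u ≡ nothing → now u ≡ nothing ⊎ ∃ λ j → j < m × u ≡ v j

    open Slid

    record Slidable : Set where
      field
        proper : Proper c
        blank  : ∀ {j} → j < K → c (v j) ≡ nothing
        v-inj  : ∀ {i j} → i < j → j < K → v i ≢ v j
        hued   : ∀ {j} → j < L → c (w (suc j)) ≡ just (κ (suc j))
        w-inj  : ∀ {i j} → i < j → j < L → w (suc i) ≢ w (suc j)
        L≤K    : L ≤ K

    open Slidable

    start : Slidable → Slid 0
    start A = record
      { now = c ; nowProper = proper A ; balance = λ _ → refl
      ; pending = λ _ → blank A ; intact = λ _ → hued A ; vacated = λ ()
      ; kept = inj₁ ; fresh = inj₁ }

    slideNext : Slidable → ∀ {m} → m < L → (S : Slid m) →
                Only (now S) (v m) (κ (suc m)) (w (suc m)) → Slid (suc m)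
    slideNext A {m} m<L S only = record
      { now       = slide (now S) (v m) (κ (suc m)) (w (suc m))
      ; nowProper = slide-proper (nowProper S) only
      ; balance   = balance′
      ; pending   = λ m<j j<K → undisturbed (v-inj A m<j j<K ∘ sym) (pending S (<⇒≤ m<j) j<K)
      ; intact    = λ m<j j<L → trans
          (slide-other (separate (hued A j<L)) (w-inj A m<j j<L ∘ sym)) (intact S (<⇒≤ m<j) j<L)
      ; vacated   = λ j<1+m → case m<1+n⇒m<n∨m≡n j<1+m of λ where
          (inj₁ j<m)  → undisturbed (separate (hued A (<-trans j<m m<L))) (vacated S j<m)
          (inj₂ refl) → slide-blank (separate (hued A m<L))
      ; kept      = λ cu → case kept S cu of λ where
          (inj₁ nu) → stays (separate cu) nu
          (inj₂ nu) → inj₂ (undisturbed (separate cu) nu)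
      ; fresh     = λ {u} cu → case u ≟ v m of λ where
          (yes refl) → inj₂ (m , ≤-refl , refl)
          (no u≢vm)  → case fresh S cu of λ where
            (inj₁ nu)           → inj₁ (undisturbed u≢vm nu)
            (inj₂ (j , j<m , eq)) → inj₂ (j , m<n⇒m<1+n j<m , eq)
      }
      where
      next : Colouring order
      next = slide (now S) (v m) (κ (suc m)) (w (suc m))
      separate : ∀ {u b} → c u ≡ just b → u ≢ v m
      separate cu refl = just≢nothing cu (blank A (<-≤-trans m<L (L≤K A)))
      stays : ∀ {u b} → u ≢ v m → now S u ≡ just b → next u ≡ just b ⊎ next u ≡ nothing
      stays {u} u≢vm nu with u ≟ w (suc m)
      ... | yes refl = inj₂ (slide-blank u≢vm)
      ... | no  u≢w  = inj₁ (trans (slide-other u≢vm u≢w) nu)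
      undisturbed : ∀ {u} → u ≢ v m → now S u ≡ nothing → next u ≡ nothing
      undisturbed {u} u≢vm nu with u ≟ w (suc m)
      ... | yes refl = slide-blank u≢vm
      ... | no  u≢w  = trans (slide-other u≢vm u≢w) nu
      swap : ∀ a b c → a + (b + c) ≡ a + c + b
      swap = solve-∀
      balance′ : ∀ wt → cost wt next + (sumTo m (λ j → wt (v j)) + wt (v m)) ≡
                        cost wt c + (sumTo m (λ j → wt (w (suc j))) + wt (w (suc m)))
      balance′ wt = begin
        cost wt next + (sumTo m (λ j → wt (v j)) + wt (v m))       ≡⟨ swap (cost wt next) _ _ ⟩
        cost wt next + wt (v m) + sumTo m (λ j → wt (v j))         ≡⟨ cong (_+ sumTo m (λ j → wt (v j))) (slide-cost
                                                                       (pending S ≤-refl (<-≤-trans m<L (L≤K A))) (intact S ≤-refl m<L) wt) ⟩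
        cost wt (now S) + wt (w (suc m)) + sumTo m (λ j → wt (v j)) ≡⟨ trans (sym (swap (cost wt (now S)) _ _)) (sym (+-assoc (cost wt (now S)) _ _)) ⟩
        cost wt (now S) + sumTo m (λ j → wt (v j)) + wt (w (suc m)) ≡⟨ cong (_+ wt (w (suc m))) (balance S wt) ⟩
        cost wt c + sumTo m (λ j → wt (w (suc j))) + wt (w (suc m)) ≡⟨ +-assoc (cost wt c) _ _ ⟩
        cost wt c + (sumTo m (λ j → wt (w (suc j))) + wt (w (suc m))) ∎
        where open ≡-Reasoning

    balance-card : ∀ {m} (S : Slid m) → card (now S) ≡ card c
    balance-card {m} S = +-cancelʳ-≡ (sumTo m (const 1)) _ _ (balance S (const 1))

  -- A cycle  w 0, v 0, w 1, v 1, …  of length 2k alternating between tokens and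
  -- coloured vertices.
  module TokenCycles (roots : List Vertex) (N : ℕ) (c : Colouring order)
    (opt : Tokens.Optimal roots N c) where

    open Tokens roots N
    open Optimal opt

    record TokenCycle (k : ℕ) : Set where
      field
        v w        : ℕ → Vertex
        κ          : ℕ → Bool
        v-periodic : Periodic k v
        w-periodic : Periodic k w
        v-simple   : ∀ i d → suc d < k → v i ≢ v (i + suc d)
        token      : ∀ i → Token c (v i)
        hued       : ∀ i → c (w i) ≡ just (κ i)
        entry      : ∀ i → v i ~ w i
        exit       : ∀ i → v i ~ w (suc i)
        3≤k        : 3 ≤ k

    rotate : ∀ {k} → ℕ → TokenCycle k → TokenCycle k
    rotate {k} a C = record
      { v = λ i → v (a + i) ; w = λ i → w (a + i) ; κ = λ i → κ (a + i)
      ; v-periodic = λ i → trans (cong v (sym (+-assoc a i k))) (v-periodic (a + i))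
      ; w-periodic = λ i → trans (cong w (sym (+-assoc a i k))) (w-periodic (a + i))
      ; v-simple   = λ i d lt eq → v-simple (a + i) d lt (trans eq (cong v (sym (+-assoc a i (suc d)))))
      ; token      = λ i → token (a + i)
      ; hued       = λ i → hued (a + i)
      ; entry      = λ i → entry (a + i)
      ; exit       = λ i → subst (λ j → v (a + i) ~ w j) (sym (+-suc a i)) (exit (a + i))
      ; 3≤k        = 3≤k
      }
      where open TokenCycle C

    -- Modulo k, multiplication by k - 1 is negation.
    reverse : ∀ {k} → TokenCycle (suc k) → TokenCycle (suc k)
    reverse {k} C = record
      { v = λ i → v (i * k) ; w = λ i → w (suc (i * k)) ; κ = λ i → κ (suc (i * k))
      ; v-periodic = λ i → trans (cong v (shift i)) (periodic-* v-periodic (i * k) k)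
      ; w-periodic = λ i → trans (cong (w ∘ suc) (shift i)) (periodic-* w-periodic (suc (i * k)) k)
      ; v-simple   = simple
      ; token      = λ i → token (i * k)
      ; hued       = λ i → hued (suc (i * k))
      ; entry      = λ i → exit (i * k)
      ; exit       = λ i → subst (v (i * k) ~_) (sym (trans (cong w (back i)) (w-periodic (i * k)))) (entry (i * k))
      ; 3≤k        = 3≤k
      }
      where
      open TokenCycle C
      shift : ∀ i → (i + suc k) * k ≡ i * k + k * suc k
      shift i = trans (*-distribʳ-+ k i (suc k)) (cong (i * k +_) (*-comm (suc k) k))
      back : ∀ i → suc (suc i * k) ≡ i * k + suc k
      back i = trans (cong suc (+-comm k (i * k))) (sym (+-suc (i * k) k))
      simple : ∀ i d → suc d < suc k → v (i * k) ≢ v ((i + suc d) * k)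
      -- With `k` written as `suc d + r`, going back `suc d` steps is going forward `suc r` steps
      -- modulo `suc k`.
      simple i d (s≤s d<k) eq with k ∸ suc d | m+[n∸m]≡n d<k
      ... | r | refl = v-simple (i * (suc d + r)) r (s≤s (s≤s (m≤n+m r d)))
        (trans eq (trans (cong v (negate i d r))
          (periodic-* v-periodic (i * (suc d + r) + suc r) d)))
        where
        negate : ∀ i d r → (i + suc d) * (suc d + r) ≡ i * (suc d + r) + suc r + d * suc (suc d + r)
        negate = solve-∀

    -- Distances along a token cycle

    module OnCycle {k : ℕ} (C : TokenCycle k) where
      open TokenCycle C

      switch : ℕ → ℕ
      switch i = bit (κ i xor κ (suc i))

      -- A coincidence yields a coloured vertex with three distinct token neighbours. For
      -- consecutive indices the third one is the token after the second vertex, and `3≤k` separates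
      -- it from the first token.
      w-injective : ∀ {i} d → suc d < k → w (suc i) ≢ w (suc (i + suc d))
      w-injective {i} zero lt eq = at-most-two-tokens opt (hued (suc i)) {v i} {v (suc i)} {v (suc (i + 1))}
        (~-sym (exit i)) (~-sym (entry (suc i))) (subst (_~ v (suc (i + 1))) (sym eq) (~-sym (entry (suc (i + 1)))))
        (token i) (token (suc i)) (token (suc (i + 1)))
        (λ e → v-simple i 0 lt (trans e (cong v (+-comm 1 i))))
        (λ e → v-simple i 1 3≤k (trans e (cong v (sym (+-suc i 1)))))
        (λ e → v-simple (suc i) 0 lt e)
      w-injective {i} (suc d) lt eq = at-most-two-tokens opt (hued (suc i)) {v i} {v (suc i)} {v (i + suc (suc d))}
        (~-sym (exit i)) (~-sym (entry (suc i))) (subst (_~ v (i + suc (suc d))) (sym eq) (~-sym (exit (i + suc (suc d)))))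
        (token i) (token (suc i)) (token (i + suc (suc d)))
        (λ e → v-simple i 0 (≤-<-trans (s≤s z≤n) lt) (trans e (cong v (+-comm 1 i))))
        (v-simple i (suc d) lt)
        (λ e → v-simple (suc i) d (<-trans ≤-refl lt) (trans e (cong v (+-suc i (suc d)))))

      w≢w⁺ : ∀ i → w i ≢ w (suc i)
      w≢w⁺ i eq = go k refl
        where
        go : ∀ k′ → k ≡ k′ → ⊥
        go zero    refl = contradiction 3≤k λ ()
        -- `w-injective` speaks of indices `suc j` only, so the pair is moved on by one period.
        go (suc k′) refl = w-injective {i + k′} 0 (≤-trans (s≤s (s≤s z≤n)) 3≤k)
          (trans (cong w (sym (+-suc i k′))) (trans (w-periodic i) (trans eq
            (trans (sym (w-periodic (suc i))) (cong (w ∘ suc) (trans (+-suc i k′) (+-comm 1 (i + k′))))))))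

      κ-periodic : Periodic k κ
      κ-periodic i = just-injective (trans (sym (hued (i + k))) (trans (cong c (w-periodic i)) (hued i)))

      -- `w i` and `w (suc i)` share a colour, so the other colour must sit on the third neighbour
      -- of `v i`.
      third-neighbour : ∀ i → κ i ≡ κ (suc i) → ∃ λ z → c z ≡ just (not (κ (suc i))) ×
        (∀ {y} → v i ~ y → y ≡ w i ⊎ y ≡ w (suc i) ⊎ y ≡ z)
      third-neighbour i same with both-colours cardMin (proj₁ (token i)) (not (κ (suc i)))
      ... | z , ez , cz = z , cz , λ ey → fourth-neighbour (entry i) (exit i) ez ey (w≢w⁺ i)
            (different-colours c (trans (hued i) (cong just same)) cz) (different-colours c (hued (suc i)) cz)

      -- The third neighbour is the only one of its colour, hence not closer than `v i`.
      parent-on-cycle : ∀ i → κ i ≡ κ (suc i) → d (w i) < d (v i) ⊎ d (w (suc i)) < d (v i)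
      parent-on-cycle i same with third-neighbour i same | parent opt (token i)
      ... | z , cz , nbrs | p , ep , lt with nbrs ep
      ...   | inj₁ refl        = inj₁ lt
      ...   | inj₂ (inj₁ refl) = inj₂ lt
      ...   | inj₂ (inj₂ refl) = contradiction lt (≤⇒≯ (only⇒δ≤ opt (token i) cz only))
        where
        only : Only c (v i) (not (κ (suc i))) p
        only x ex cx with nbrs ex
        ... | inj₁ refl       = contradiction refl (different-colours c (trans (hued i) (cong just same)) cx)
        ... | inj₂ (inj₁ refl) = contradiction refl (different-colours c (hued (suc i)) cx)
        ... | inj₂ (inj₂ x≡p) = x≡p

      d-entry : ∀ i → d (w i) ≤ suc (d (v i))
      d-entry i = Distance.δ-lipschitz roots N (~-sym (entry i))

      d-exit : ∀ i → d (w (suc i)) ≤ suc (d (v i))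
      d-exit i = Distance.δ-lipschitz roots N (~-sym (exit i))

      switch-same : ∀ {i} → κ i ≡ κ (suc i) → switch i ≡ 0
      switch-same {i} same = cong bit (trans (cong (_xor κ (suc i)) same) (Bool.xor-same (κ (suc i))))

      switch-differ : ∀ {i} → κ i ≢ κ (suc i) → switch i ≡ 1
      switch-differ {i} differ with κ i | κ (suc i)
      ... | false | false = contradiction refl differ
      ... | false | true  = refl
      ... | true  | false = refl
      ... | true  | true  = contradiction refl differ

      -- An upper bound for the average of `d (w i)` and `d (w (suc i))`; over the cycle it sums to
      -- Σ d(vᵢ) + σ.
      detour : ℕ → ℕ
      detour i = d (v i) + switch i

      detour-same : ∀ {i} → κ i ≡ κ (suc i) → detour i ≡ d (v i)
      detour-same {i} same = trans (cong (d (v i) +_) (switch-same same)) (+-identityʳ _)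

      detour-differ : ∀ {i} → κ i ≢ κ (suc i) → detour i ≡ suc (d (v i))
      detour-differ {i} differ = trans (cong (d (v i) +_) (switch-differ differ)) (+-comm _ 1)

      detour-bound : ∀ i → d (w i) + d (w (suc i)) ≤ detour i + detour i
      detour-bound i with κ i Bool.≟ κ (suc i)
      ... | no differ = subst (λ x → d (w i) + d (w (suc i)) ≤ x + x) (sym (detour-differ differ))
                          (+-mono-≤ (d-entry i) (d-exit i))
      ... | yes same  = subst (λ x → d (w i) + d (w (suc i)) ≤ x + x) (sym (detour-same same))
                          (bound (parent-on-cycle i same))
        where
        bound : d (w i) < d (v i) ⊎ d (w (suc i)) < d (v i) → d (w i) + d (w (suc i)) ≤ d (v i) + d (v i)
        bound (inj₁ lt) = descent-bound lt (d-exit i)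
        bound (inj₂ lt) = ≤-trans (≤-reflexive (+-comm (d (w i)) _)) (descent-bound lt (d-entry i))

      β : ℕ → Bool
      β i = odd ⌊ d (w i) /2⌋ xor κ i

      -- At a switch both Lipschitz bounds are attained, so the distance stays and the colour
      -- changes. At a nonswitch the colour stays and the distance changes by 2, its rounded half by
      -- 1.
      tight⇒flip : ∀ i → d (w i) + d (w (suc i)) ≡ detour i + detour i → β (suc i) ≡ not (β i)
      tight⇒flip i eq with κ i Bool.≟ κ (suc i)
      ... | no differ = trans
        (cong₂ (λ x b → odd ⌊ x /2⌋ xor b)
          (sym (equal-halves (d-entry i) (d-exit i) (trans eq (cong (λ x → x + x) (detour-differ differ)))))
          (Bool.¬-not (differ ∘ sym)))
        (sym (Bool.not-distribʳ-xor (odd ⌊ d (w i) /2⌋) (κ i)))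
      ... | yes same = flip (parent-on-cycle i same)
        where
        eq′ : d (w i) + d (w (suc i)) ≡ d (v i) + d (v i)
        eq′ = trans eq (cong (λ x → x + x) (detour-same same))
        flip : d (w i) < d (v i) ⊎ d (w (suc i)) < d (v i) → β (suc i) ≡ not (β i)
        flip (inj₁ lt) = trans
          (cong₂ (λ x b → odd ⌊ x /2⌋ xor b) (descent-tight lt (d-exit i) eq′) (sym same))
          (sym (Bool.not-distribˡ-xor (odd ⌊ d (w i) /2⌋) (κ i)))
        flip (inj₂ lt) = trans (sym (Bool.not-involutive (β (suc i)))) (cong not (sym (trans
          (cong₂ (λ x b → odd ⌊ x /2⌋ xor b)
            (descent-tight lt (d-entry i) (trans (+-comm (d (w (suc i))) _) eq′)) same)
          (sym (Bool.not-distribˡ-xor (odd ⌊ d (w (suc i)) /2⌋) (κ (suc i)))))))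

      -- The lower bound to be obtained by sliding. Against `detour-bound` it leaves no slack at any
      -- index.
      Tight : Set
      Tight = sumTo k detour ≤ sumTo k (λ j → d (w (suc j)))

      tight⇒even : Tight → odd k ≢ true
      tight⇒even tight isOdd = Bool.not-¬ refl (sym (begin
        not (β 0)      ≡⟨ cong (_xor β 0) (sym isOdd) ⟩
        odd k xor β 0  ≡⟨ sym (alternating k β λ i i<k → tight⇒flip i (equality i i<k)) ⟩
        β k            ≡⟨ cong₂ (λ x b → odd ⌊ d x /2⌋ xor b) (w-periodic 0) (κ-periodic 0) ⟩
        β 0            ∎))
        where
        open ≡-Reasoning
        -- Over a whole period a shift does not change the sum, so `Tight` bounds both sums of
        -- distances.
        Σw≡Σw⁺ : sumTo k (λ j → d (w j)) ≡ sumTo k (λ j → d (w (suc j)))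
        Σw≡Σw⁺ = sym (+-cancelˡ-≡ (d (w 0)) _ _ (trans (sumTo-suc k (λ j → d (w j)))
          (trans (cong (λ x → sumTo k (λ j → d (w j)) + d x) (w-periodic 0)) (+-comm _ (d (w 0))))))
        equality : ∀ i → i < k → d (w i) + d (w (suc i)) ≡ detour i + detour i
        equality = sumTo-tight k (λ i _ → detour-bound i)
          (≤-trans (≤-reflexive (sumTo-distrib k detour detour))
          (≤-trans (+-mono-≤ (≤-trans tight (≤-reflexive (sym Σw≡Σw⁺))) tight)
            (≤-reflexive (sym (sumTo-distrib k (λ j → d (w j)) (λ j → d (w (suc j))))))))

      apart : ∀ {i j} → i < j → j < k → ∃ λ e → i + suc e ≡ j × suc e < k
      apart {i} {j} i<j j<k with m≤n⇒∃[o]m+o≡n i<j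
      ... | e , eq = e , trans (+-suc i e) eq ,
            ≤-<-trans (≤-trans (m≤n+m (suc e) i) (≤-reflexive (trans (+-suc i e) eq))) j<k

      v-distinct : ∀ {i j} → i < j → j < k → v i ≢ v j
      v-distinct {i} i<j j<k with apart i<j j<k
      ... | e , refl , e<k = v-simple i e e<k

      w-distinct : ∀ {i j} → i < j → j < k → w (suc i) ≢ w (suc j)
      w-distinct {i} i<j j<k with apart i<j j<k
      ... | e , refl , e<k = w-injective e e<k

      v≢w : ∀ i j → v i ≢ w j
      v≢w i j eq = just≢nothing (hued j) (trans (cong c (sym eq)) (proj₁ (token i)))

      ExitOnly : ℕ → Set
      ExitOnly i = Only c (v i) (κ (suc i)) (w (suc i))

      -- Sliding along the cycle from a switch

      module _ (switch₀ : κ 0 ≢ κ 1) (exit₀ : ExitOnly 0) where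

        open Slides c k k v w κ
        open Slid

        slidable : Slidable
        slidable = record
          { proper = proj₁ cardMin
          ; blank  = λ {j} _ → proj₁ (token j)
          ; v-inj  = v-distinct
          ; hued   = λ {j} _ → hued (suc j)
          ; w-inj  = w-distinct
          ; L≤K    = ≤-refl
          }

        slid-cardMin : ∀ {m} (S : Slid m) → CardMin (now S)
        slid-cardMin S = cardMin-transfer cardMin (nowProper S) (balance-card S)

        slid-rooted : ∀ {m} (S : Slid m) → Rooted (now S)
        slid-rooted S r∈ = case fresh S (rooted r∈) of λ where
          (inj₁ nr)           → nr
          (inj₂ (j , _ , refl)) → contradiction r∈ (proj₂ (token j))

        -- The previous slide left `w (suc m)` uncoloured next to `v (suc m)`, so `blank⇒only`
        -- applies. Only the very first slide relies on `exit₀`.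
        slid-only : ∀ m → suc m < k → (S : Slid (suc m)) →
                    Only (now S) (v (suc m)) (κ (suc (suc m))) (w (suc (suc m)))
        slid-only m m<k S = blank⇒only (slid-cardMin S) (pending S ≤-refl m<k)
          (entry (suc m)) (vacated S ≤-refl) (exit (suc m)) (intact S ≤-refl m<k)

        slidOn : ∀ m → suc m < k → Slid (suc m) → Slid (suc (suc m))
        slidOn m m<k S = slideNext slidable m<k S (slid-only m m<k S)

        slid : ∀ m → m < k → Slid m
        slid zero          _   = start slidable
        slid (suc zero)    m<k = slideNext slidable (<⇒≤ m<k) (start slidable) exit₀
        slid (suc (suc m)) m<k = slidOn m (<⇒≤ m<k) (slid (suc m) (<⇒≤ m<k))

        -- After the slides w (suc m) and v (suc m) are adjacent tokens, so the
        -- colouring is no longer optimal.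
        slide-gain : ∀ m → suc m < k → sumTo (suc m) (λ j → d (v j)) < sumTo (suc m) (λ j → d (w (suc j)))
        slide-gain m m<k = ≰⇒> λ Σw≤Σv → tokens-independent (opt′ Σw≤Σv)
          (pending S ≤-refl m<k , proj₂ (token (suc m)))
          (vacated S ≤-refl , λ w∈ → just≢nothing (hued (suc m)) (rooted w∈))
          (entry (suc m))
          where
          S : Slid (suc m)
          S = slid (suc m) m<k
          opt′ : sumTo (suc m) (λ j → d (w (suc j))) ≤ sumTo (suc m) (λ j → d (v j)) → Optimal (now S)
          opt′ Σw≤Σv = optimal-transfer opt (slid-cardMin S) (slid-rooted S)
            (+-cancelʳ-≤ (sumTo (suc m) (λ j → d (v j))) _ _
              (≤-trans (≤-reflexive (balance S d)) (+-monoʳ-≤ (cost d c) Σw≤Σv)))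

        -- Slide up to `v m`. A neighbour of colour `κ (suc m)` either kept its colour and is
        -- `w (suc m)`, or lost it and is `w m`, whose colour differs at a switch.
        exits : ∀ m → m < k → κ m ≢ κ (suc m) → ExitOnly m
        exits zero    _   _      = exit₀
        exits (suc m) m<k differ y ey cy = case kept S cy of λ where
            (inj₁ ny) → slid-only m m<k S y ey ny
            (inj₂ ny) → contradiction
              (just-injective (trans (sym (hued (suc m))) (trans (cong c (blank-unique (slid-cardMin S)
                (pending S ≤-refl m<k) (entry (suc m)) (vacated S ≤-refl) ey ny)) cy)))
              differ
          where
          S : Slid (suc m)
          S = slid (suc m) m<k

    -- The lower bound for a cycle with a switch

    module _ {k : ℕ} (C : TokenCycle k) where
      open TokenCycle C
      open OnCycle C

      module _ (switch₀ : κ 0 ≢ κ 1) (exit₀ : ExitOnly 0) where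

        ascent : ℕ → ℕ
        ascent j = d (w (suc j))

        segment-gain : ∀ b e → b < k → κ b ≢ κ (suc b) → suc e < k →
          sumTo (suc e) (λ j → d (v (b + j))) < sumTo (suc e) (λ j → ascent (b + j))
        segment-gain b e b<k switch-b e<k = subst
          (sumTo (suc e) (λ j → d (v (b + j))) <_)
          (sumTo-cong (suc e) (λ j → cong (λ i → d (w i)) (+-suc b j)))
          (OnCycle.slide-gain (rotate b C)
            (λ eq → switch-b (trans (cong κ (sym (+-identityʳ b))) (trans eq (cong κ (+-comm b 1)))))
            (subst₂ (λ i j → Only c (v i) (κ j) (w j)) (sym (+-identityʳ b)) (+-comm 1 b)
              (exits switch₀ exit₀ b b<k switch-b))
            e e<k)

        -- The progress made along the cycle up to m, where b is the last switch before m
        record Progress (m : ℕ) : Set where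
          field
            b e      : ℕ
            b+1+e≡m  : b + suc e ≡ m
            b<k      : b < k
            switch-b : κ b ≢ κ (suc b)
            steady   : κ (suc b) ≡ κ m
            switches : sumTo (suc e) (λ j → switch (b + j)) ≤ 1
            earlier  : sumTo b detour ≤ sumTo b ascent

        -- The segment starting at `b` contains at most one switch, which the strict inequality of
        -- `segment-gain` pays for.
        complete : ∀ {m} (P : Progress m) → suc (Progress.e P) < k → sumTo m detour ≤ sumTo m ascent
        complete record { b = b ; e = e ; b+1+e≡m = refl ; b<k = b<k ; switch-b = sb ; switches = sw ; earlier = ea } e<k = begin
          sumTo (b + suc e) detour
            ≡⟨ sumTo-+ b (suc e) detour ⟩
          sumTo b detour + sumTo (suc e) (λ j → d (v (b + j)) + switch (b + j))
            ≡⟨ cong (sumTo b detour +_) (sumTo-distrib (suc e) (λ j → d (v (b + j))) (λ j → switch (b + j))) ⟩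
          sumTo b detour + (sumTo (suc e) (λ j → d (v (b + j))) + sumTo (suc e) (λ j → switch (b + j)))
            ≤⟨ +-mono-≤ ea (≤-trans (+-monoʳ-≤ (sumTo (suc e) (λ j → d (v (b + j)))) sw)
                 (≤-trans (≤-reflexive (+-comm _ 1)) (segment-gain b e b<k sb e<k))) ⟩
          sumTo b ascent + sumTo (suc e) (λ j → ascent (b + j))
            ≡⟨ sym (sumTo-+ b (suc e) ascent) ⟩
          sumTo (b + suc e) ascent ∎
          where open ≤-Reasoning

        progress : ∀ m → suc m ≤ k → Progress (suc m)
        progress zero    1≤k = record
          { b = 0 ; e = 0 ; b+1+e≡m = refl ; b<k = 1≤k ; switch-b = switch₀ ; steady = refl
          ; switches = ≤-reflexive (switch-differ switch₀) ; earlier = z≤n }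
        progress (suc m) 2+m≤k with progress m (<⇒≤ 2+m≤k) | κ (suc m) Bool.≟ κ (suc (suc m))
        ... | P | no differ = record
          { b = suc m ; e = 0 ; b+1+e≡m = +-comm (suc m) 1 ; b<k = 2+m≤k ; switch-b = differ
          ; steady = refl
          ; switches = ≤-reflexive (trans (cong switch (+-identityʳ (suc m))) (switch-differ differ))
          ; earlier = complete P (≤-<-trans (≤-trans (m≤n+m (suc e) b) (≤-reflexive b+1+e≡m)) 2+m≤k) }
          where open Progress P
        ... | P | yes same = record
          { b = b ; e = suc e ; b+1+e≡m = trans (+-suc b (suc e)) (cong suc b+1+e≡m)
          ; b<k = b<k ; switch-b = switch-b ; steady = trans steady same
          ; switches = ≤-trans (≤-reflexive (trans
              (cong (sumTo (suc e) (λ j → switch (b + j)) +_)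
                (trans (cong switch b+1+e≡m) (switch-same same)))
              (+-identityʳ _))) switches
          ; earlier = earlier }
          where open Progress P

        switched⇒tight : Tight
        switched⇒tight = go k refl
          where
          go : ∀ m → m ≡ k → Tight
          go zero    refl = contradiction 3≤k λ ()
          go (suc m) refl with progress m ≤-refl
          -- The last segment starts after 0, since otherwise the colour would be constant from 1 to
          -- the period, against the switch at 0. So it is shorter than the cycle, as `complete`
          -- requires.
          ... | P@record { b = suc b ; b+1+e≡m = eq } =
                complete P (≤-trans (s≤s (m≤n+m _ b)) (≤-reflexive eq))
          ... | record { b = zero ; steady = steady } =
                contradiction (sym (trans steady (κ-periodic 0))) switch₀

    -- The lower bound for a cycle without switches

    module _ {k : ℕ} (C : TokenCycle (suc k)) where
      open TokenCycle C
      open OnCycle C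

      module _ (constant : ∀ i → i < suc k → κ i ≡ κ (suc i)) where

        -- Uncolouring w (suc k) ≡ w 0 first makes w 1 the only neighbour of v 0
        -- of its colour; the vertex lost is regained by colouring v k last.
        c₀ : Colouring order
        c₀ = c [ w (suc k) ≔ nothing ]

        c₀-other : ∀ {u} → u ≢ w (suc k) → c₀ u ≡ c u
        c₀-other {u} u≢ = updateAt-minimal u (w (suc k)) c u≢

        open Slides c₀ (suc k) k v w κ
        open Slid

        shiftable : Slidable
        shiftable = record
          { proper = proper-uncolour (w (suc k)) (proj₁ cardMin)
          ; blank  = λ {j} _ → trans (c₀-other (v≢w j (suc k))) (proj₁ (token j))
          ; v-inj  = v-distinct
          ; hued   = λ {j} j<k → trans (c₀-other (w-distinct j<k ≤-refl)) (hued (suc j))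
          ; w-inj  = λ i<j j<k → w-distinct i<j (m<n⇒m<1+n j<k)
          ; L≤K    = n≤1+n k
          }

        last-blank : ∀ {m} (S : Slid m) → now S (w (suc k)) ≡ nothing
        last-blank S = case fresh S (updateAt-updates (w (suc k)) c) of λ where
          (inj₁ nw)           → nw
          (inj₂ (j , _ , eq)) → contradiction (sym eq) (v≢w j (suc k))

        entry-blank : ∀ {m} (S : Slid m) → now S (w m) ≡ nothing
        entry-blank {zero}  S = trans (cong (now S) (sym (w-periodic 0))) (last-blank S)
        entry-blank {suc m} S = vacated S ≤-refl

        -- Of the neighbours of `v m`, `w m` is uncoloured by now and the third has the other
        -- colour. A neighbour coloured only by the slides would be a token adjacent to `v m`.
        shift-only : ∀ {m} → m < suc k → (S : Slid m) → Only (now S) (v m) (κ (suc m)) (w (suc m))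
        shift-only {m} m≤k S y ey ny = by-colour (c y) refl
          where
          y≢last : y ≢ w (suc k)
          y≢last refl = just≢nothing ny (last-blank S)
          by-neighbour : ∀ {z} → c z ≡ just (not (κ (suc m))) → y ≡ w m ⊎ y ≡ w (suc m) ⊎ y ≡ z →
                         y ≡ w (suc m)
          by-neighbour cz (inj₁ refl)        = contradiction (entry-blank S) (just≢nothing ny)
          by-neighbour cz (inj₂ (inj₁ y≡w))  = y≡w
          by-neighbour cz (inj₂ (inj₂ refl)) = case kept S (trans (c₀-other y≢last) cz) of λ where
            (inj₁ ny′) → contradiction (just-injective (trans (sym ny) ny′)) (Bool.not-¬ refl)
            (inj₂ ny′) → contradiction ny′ (just≢nothing ny)
          by-colour : ∀ x → c y ≡ x → y ≡ w (suc m)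
          by-colour nothing  cy = case fresh S (trans (c₀-other y≢last) cy) of λ where
            (inj₁ ny′)            → contradiction ny′ (just≢nothing ny)
            (inj₂ (j , _ , refl)) → contradiction ey (tokens-independent opt (token m) (token j))
          by-colour (just b) cy = case third-neighbour m (constant m m≤k) of λ where
            (z , cz , nbrs) → by-neighbour cz (nbrs ey)

        shiftOn : ∀ m → m < k → Slid m → Slid (suc m)
        shiftOn m m<k S = slideNext shiftable m<k S (shift-only (m<n⇒m<1+n m<k) S)

        shift : ∀ m → m ≤ k → Slid m
        shift zero    _   = start shiftable
        shift (suc m) m<k = shiftOn m m<k (shift m (<⇒≤ m<k))

        S : Slid k
        S = shift k ≤-refl

        c₁ : Colouring order
        c₁ = now S [ v k ≔ just (κ (suc k)) ]

        c₁-proper : Proper c₁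
        -- A neighbour in the way would be `w (suc k)`, which has been uncoloured from the start.
        c₁-proper = proper-colour (v k) (κ (suc k)) (nowProper S) λ y ey ny →
          contradiction (trans (cong (now S) (shift-only ≤-refl S y ey ny)) (last-blank S)) (just≢nothing ny)

        balance₁ : ∀ wt → cost wt c₁ + sumTo (suc k) (λ j → wt (v j)) ≡
                          cost wt c + sumTo (suc k) (λ j → wt (w (suc j)))
        balance₁ wt = begin
          cost wt c₁ + (V + wt (v k))                 ≡⟨ swap (cost wt c₁) V (wt (v k)) ⟩
          cost wt c₁ + wt (v k) + V                   ≡⟨ cong (_+ V) (cost-colour wt (now S) (v k) (κ (suc k))
                                                           (pending S ≤-refl ≤-refl)) ⟩
          cost wt (now S) + V                         ≡⟨ balance S wt ⟩
          cost wt c₀ + W                              ≡⟨ cong (_+ W) (cost-uncolour wt c (hued (suc k))) ⟩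
          cost wt c + wt (w (suc k)) + W              ≡⟨ sym (swap (cost wt c) W (wt (w (suc k)))) ⟩
          cost wt c + (W + wt (w (suc k)))            ∎
          where
          open ≡-Reasoning
          V W : ℕ
          V = sumTo k (λ j → wt (v j))
          W = sumTo k (λ j → wt (w (suc j)))
          swap : ∀ a b c → a + (b + c) ≡ a + c + b
          swap = solve-∀

        c₁-cardMin : CardMin c₁
        c₁-cardMin = cardMin-transfer cardMin c₁-proper
          (+-cancelʳ-≡ (sumTo (suc k) (const 1)) _ _ (balance₁ (const 1)))

        c₁-rooted : Rooted c₁
        c₁-rooted {r} r∈ = trans (updateAt-minimal r (v k) (now S) λ { refl → proj₂ (token k) r∈ })
          (case fresh S (trans (c₀-other λ { refl → just≢nothing (hued (suc k)) (rooted r∈) }) (rooted r∈)) of λ where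
            (inj₁ nr)            → nr
            (inj₂ (j , _ , refl)) → contradiction r∈ (proj₂ (token j)))

        constant⇒tight : Tight
        constant⇒tight = ≤-trans
          (sumTo-mono-≤ (suc k) λ i i<k → ≤-reflexive (detour-same (constant i i<k)))
          (+-cancelˡ-≤ (cost d c) _ _ (≤-trans
            (+-monoˡ-≤ (sumTo (suc k) (λ j → d (v j))) (least c₁-cardMin c₁-rooted))
            (≤-reflexive (balance₁ d))))

    -- Parity of token cycles

    -- `w 0` and `w 1` have different colours, and the third neighbour of `v 0` shares at most one
    -- of them. So in one of the two directions the cycle leaves `v 0` through the only neighbour of
    -- its colour.
    switched⇒even : ∀ {k} (C : TokenCycle (suc k)) → TokenCycle.κ C 0 ≢ TokenCycle.κ C 1 → odd (suc k) ≢ true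
    switched⇒even {k} C switch₀
      with any? (λ y → ¬? (y ≟ w 1) ×-dec (v 0 ~? y) ×-dec Maybe.≡-dec Bool._≟_ (c y) (just (κ 1)))
      where open TokenCycle C
    ... | no none = OnCycle.tight⇒even C (switched⇒tight C switch₀ λ y ey cy →
            decidable-stable (y ≟ w 1) λ y≢ → none (y , y≢ , ey , cy))
      where open TokenCycle C
    ... | yes (y , y≢ , ey , cy) = OnCycle.tight⇒even R (switched⇒tight R
            (λ eq → switch₀ (trans (sym κ-back) (sym eq))) only)
      where
      open TokenCycle C
      R : TokenCycle (suc k)
      R = reverse C
      w-back : TokenCycle.w R 1 ≡ w 0
      w-back = trans (cong (w ∘ suc) (+-identityʳ k)) (w-periodic 0)
      κ-back : TokenCycle.κ R 1 ≡ κ 0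
      κ-back = trans (cong (κ ∘ suc) (+-identityʳ k)) (OnCycle.κ-periodic C 0)
      only : Only c (v 0) (TokenCycle.κ R 1) (TokenCycle.w R 1)
      only x ex cx = case fourth-neighbour (entry 0) (exit 0) ey ex (OnCycle.w≢w⁺ C 0)
             (λ { refl → switch₀ (just-injective (trans (sym (hued 0)) cy)) }) (y≢ ∘ sym) of λ where
          (inj₁ x≡w0)        → trans x≡w0 (sym w-back)
          (inj₂ (inj₁ refl)) → contradiction (clash (hued 1)) switch₀
          (inj₂ (inj₂ refl)) → contradiction (clash cy) switch₀
        where
        clash : c x ≡ just (κ 1) → κ 0 ≡ κ 1
        clash cx′ = just-injective (trans (cong just (sym κ-back)) (trans (sym cx) cx′))

    no-odd-cycle : ∀ {k} → TokenCycle k → odd k ≢ true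
    no-odd-cycle {zero}  C = λ ()
    no-odd-cycle {suc k} C with anyUpTo? (λ i → ¬? (κ i Bool.≟ κ (suc i))) (suc k)
      where open TokenCycle C
    ... | no none = OnCycle.tight⇒even C (constant⇒tight C λ i i<k →
            decidable-stable (κ i Bool.≟ κ (suc i)) λ differ → none (i , i<k , differ))
      where open TokenCycle C
    ... | yes (i , _ , differ) = switched⇒even (rotate i C)
            λ eq → differ (trans (cong κ (sym (+-identityʳ i))) (trans eq (cong κ (+-comm i 1))))
      where open TokenCycle C

  open Data.List.Membership.DecPropositional (_≟_ {order}) using (_∈?_)

  -- The conflict graph of the tokens

  module Conflicts (roots : List Vertex) (N : ℕ) (c : Colouring order)
    (opt : Tokens.Optimal roots N c) where

    open Tokens roots N
    open Optimal opt
    open TokenCycles roots N c opt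

    token? : ∀ v → Dec (Token c v)
    token? v = Maybe.≡-dec Bool._≟_ (c v) nothing ×-dec ¬? (v ∈? roots)

    infix 4 _#_
    _#_ : Vertex → Vertex → Set
    u # v = Token c u × Token c v × u ≢ v × ∃ λ w → u ~ w × v ~ w

    _#?_ : ∀ u v → Dec (u # v)
    u #? v = token? u ×-dec token? v ×-dec ¬? (u ≟ v) ×-dec any? λ w → (u ~? w) ×-dec (v ~? w)

    #-sym : ∀ {u v} → u # v → v # u
    #-sym (tu , tv , u≢v , w , uw , vw) = tv , tu , u≢v ∘ sym , w , vw , uw

    -- A function of the two vertices alone, with a default value, so that it inherits the
    -- periodicity of a closed walk.
    middle : Vertex → Vertex → Vertex
    middle u v with any? (λ w → (u ~? w) ×-dec (v ~? w))
    ... | yes (w , _) = w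
    ... | no  _       = u

    middle-common : ∀ {u v} → u # v → u ~ middle u v × v ~ middle u v
    middle-common {u} {v} (_ , _ , _ , common) with any? (λ w → (u ~? w) ×-dec (v ~? w))
    ... | yes (_ , both) = both
    ... | no  none       = contradiction common none

    -- An uncoloured common neighbour would have two uncoloured neighbours, against `blank-unique`.
    middle-hued : ∀ {u v} → u # v → c (middle u v) ≡ just (fromMaybe false (c (middle u v)))
    middle-hued {u} {v} uv@((cu , _) , (cv , _) , u≢v , _) = go (c (middle u v)) refl
      where
      go : ∀ x → c (middle u v) ≡ x → x ≡ just (fromMaybe false x)
      go (just _) _  = refl
      go nothing  cm = contradiction
        (blank-unique cardMin cm (~-sym (proj₁ (middle-common uv))) cu (~-sym (proj₂ (middle-common uv))) cv)
        u≢v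

    toTokenCycle : ∀ {k} (C : OddClosed _#_ k) → Simple _#_ C → TokenCycle k
    toTokenCycle {k} C simple = record
      { v          = λ i → at (suc i)
      ; w          = λ i → middle (at i) (at (suc i))
      ; κ          = λ i → fromMaybe false (c (middle (at i) (at (suc i))))
      ; v-periodic = λ i → periodic (suc i)
      ; w-periodic = λ i → cong₂ middle (periodic i) (periodic (suc i))
      ; v-simple   = λ i d → simple (suc i) d
      ; token      = λ i → proj₁ (step (suc i))
      ; hued       = λ i → middle-hued (step i)
      ; entry      = λ i → proj₂ (middle-common (step i))
      ; exit       = λ i → proj₁ (middle-common (step (suc i)))
      ; 3≤k        = long k isOdd periodic
      }
      where
      open OddClosed C
      long : ∀ k → odd k ≡ true → Periodic k at → 3 ≤ k
      -- Period 1 would put a vertex in conflict with itself; parity excludes 0 and 2.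
      long (suc zero)          _ p = contradiction (sym (p 0)) (proj₁ (proj₂ (proj₂ (step 0))))
      long (suc (suc (suc k))) _ _ = s≤s (s≤s (s≤s z≤n))

    conflict-bipartite : ∃ λ (γ : Vertex → Bool) → ∀ {u v} → u # v → γ u ≢ γ v
    conflict-bipartite with bipartite⊎oddCycle _#?_ #-sym
    ... | inj₁ γ              = γ
    ... | inj₂ (k , C , simple) =
      contradiction (OddClosed.isOdd C) (no-odd-cycle (toTokenCycle C simple))

  record Packing : Set₁ where
    field
      roots  : List Vertex
      c      : Colouring order
      γ      : Vertex → Bool
      proper : Proper c
      far    : ∀ {u v} → u ∈ roots → v ∈ roots → u ≢ v → ¬ Within 3 u v
      lonely : ∀ {u v} → c u ≡ nothing → u ∉ roots → c v ≡ nothing → v ∉ roots → u ≢ v →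
               γ u ≡ γ v → ¬ Within 2 u v

  private
    blank? : ∀ (c : Colouring order) v → Dec (c v ≡ nothing)
    blank? c v = Maybe.≡-dec Bool._≟_ (c v) nothing

  fewest : ∃ CardMin
  fewest = case minimise proper? proper-resp (const 1) ((λ _ → nothing) , λ _ _ _ _ ()) of λ where
    (c , proper , min) → c , proper , min

  -- Existence of an optimal colouring

  module Existence (c₀ : Colouring order) (min₀ : CardMin c₀) where

    blanks roots : List Vertex
    blanks = filter (blank? c₀) (allFin order)
    roots  = scattered blanks

    -- Large enough that no distance from an optimal colouring's tokens is truncated.
    N : ℕ
    N = suc (cost (const 3) c₀)

    open Tokens roots N

    rooted₀ : Rooted c₀
    rooted₀ r∈ = All.lookup (all-filter (blank? c₀) (allFin order)) (scattered-⊆ blanks r∈)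

    -- The 3 is the domination radius of the greedily chosen roots.
    cost-d₀ : cost d c₀ ≤ cost (const 3) c₀
    cost-d₀ = cost-mono-≤ d (const 3) c₀ λ v cv →
      Distance.near⇒δ≤ roots N (scattered-dominates blanks (∈-filter⁺ (blank? c₀) (∈-allFin v) cv))

    -- As `c₀` is minimal, the bound by `card c₀` is a decidable substitute for `CardMin`.
    Candidate : Colouring order → Set
    Candidate c = Proper c × card c ≤ card c₀ × All (λ r → c r ≡ nothing) roots

    candidate? : ∀ c → Dec (Candidate c)
    candidate? c = proper? c ×-dec (card c ≤? card c₀) ×-dec All.all? (blank? c) roots

    candidate-resp : ∀ {c c′} → c ≗ c′ → Candidate c → Candidate c′
    candidate-resp c≗c′ (p , le , rt) = proper-resp c≗c′ p ,
      subst (_≤ card c₀) (cost-cong (const 1) c≗c′) le , All.map (trans (sym (c≗c′ _))) rt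

    optimum : ∃ Optimal
    optimum = case minimise candidate? candidate-resp d
                     (c₀ , proj₁ min₀ , ≤-refl , All.tabulate rooted₀) of λ where
      (c , (proper , le , rt) , least) → c , record
        { cardMin = proper , λ c′ p′ → ≤-trans le (proj₂ min₀ c′ p′)
        ; rooted  = All.lookup rt
        ; least   = λ {c′} (p′ , min′) rt′ → least c′ (p′ , min′ c₀ (proj₁ min₀) , All.tabulate rt′)
        ; small   = s≤s (≤-trans (least c₀ (proj₁ min₀ , ≤-refl , All.tabulate rooted₀)) cost-d₀)
        }

    packing : Packing
    packing with optimum
    ... | c , opt = record
      { roots  = roots
      ; c      = c
      ; γ      = proj₁ conflict-bipartite
      ; proper = proj₁ (Optimal.cardMin opt)
      ; far    = scattered-far blanks
      ; lonely = λ cu u∉ cv v∉ u≢v γ≡ → λ where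
          (inj₁ (inj₁ u≡v))                          → u≢v u≡v
          (inj₁ (inj₂ (_ , e , refl)))               → tokens-independent opt (cu , u∉) (cv , v∉) e
          (inj₂ (_ , e , inj₁ refl))                 → tokens-independent opt (cu , u∉) (cv , v∉) e
          (inj₂ (x , e , inj₂ (_ , f , refl)))       →
            proj₂ conflict-bipartite ((cu , u∉) , (cv , v∉) , u≢v , x , e , ~-sym f) γ≡
      }
      where open Conflicts roots N c opt

  -- From the five classes to a packing colouring of the subdivision

  module Subdivide (P : Packing) where
    open Packing P

    data Kind : Set where
      coloured token : Bool → Kind
      root           : Kind

    Describes : Kind → Vertex → Set
    Describes (coloured b) v = c v ≡ just b
    Describes root         v = v ∈ roots
    Describes (token b)    v = c v ≡ nothing × v ∉ roots × γ v ≡ b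

    classify : ∀ v → ∃ λ κ → Describes κ v
    classify v with c v in cv | v ∈? roots
    ... | just b  | _      = coloured b , cv
    ... | nothing | yes v∈ = root , v∈
    ... | nothing | no v∉  = token (γ v) , cv , v∉ , refl

    code : Kind → Fin 6
    code (coloured false) = suc zero
    code (coloured true)  = suc (suc zero)
    code (token false)    = suc (suc (suc zero))
    code (token true)     = suc (suc (suc (suc zero)))
    code root             = suc (suc (suc (suc (suc zero))))

    decode : Fin 6 → Kind
    -- A default: `code` never takes the value `zero`, which is kept for the subdivision vertices.
    decode zero                                   = root
    decode (suc zero)                             = coloured false
    decode (suc (suc zero))                       = coloured true
    decode (suc (suc (suc zero)))                 = token false
    decode (suc (suc (suc (suc zero))))           = token true
    decode (suc (suc (suc (suc (suc zero)))))     = root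

    decode-code : ∀ κ → decode (code κ) ≡ κ
    decode-code (coloured false) = refl
    decode-code (coloured true)  = refl
    decode-code (token false)    = refl
    decode-code (token true)     = refl
    decode-code root             = refl

    radius : Kind → ℕ
    radius (coloured _) = 1
    radius (token _)    = 2
    radius root         = 3

    separated : ∀ κ {u v} → Describes κ u → Describes κ v → u ≢ v → ¬ Within (radius κ) u v
    separated (coloured b) cu cv u≢v (inj₁ u≡v)            = u≢v u≡v
    separated (coloured b) cu cv u≢v (inj₂ (_ , e , refl)) = proper _ _ e b cu cv
    separated (token b) (cu , u∉ , γu) (cv , v∉ , γv) u≢v  =
      lonely cu u∉ cv v∉ u≢v (trans γu (sym γv))
    separated root u∈ v∈ u≢v                               = far u∈ v∈ u≢v

    -- Distances double in the subdivision. So vertices of one kind are at distance at least 4 for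
    -- colours 2 and 3, at least 6 for 4 and 5, and at least 8 for 6.
    code-bound : ∀ κ → oneTo 6 (code κ) + 1 ≤ suc (radius κ) + suc (radius κ)
    code-bound (coloured false) = s≤s (s≤s (s≤s z≤n))
    code-bound (coloured true)  = ≤-refl
    code-bound (token false)    = s≤s (s≤s (s≤s (s≤s (s≤s z≤n))))
    code-bound (token true)     = ≤-refl
    code-bound root             = s≤s (s≤s (s≤s (s≤s (s≤s (s≤s (s≤s z≤n))))))

    hue : Vertex → Fin 6
    hue v = code (proj₁ (classify v))

    hue-separates : ∀ {u v m} → u ≢ v → hue u ≡ hue v → Within m u v → oneTo 6 (hue u) + 1 ≤ m + m
    hue-separates {u} {v} {m} u≢v eq p = ≤-trans (code-bound κ) (+-mono-≤ κ<m κ<m)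
      where
      κ : Kind
      κ = proj₁ (classify u)
      κ≡ : proj₁ (classify v) ≡ κ
      κ≡ = trans (sym (decode-code _)) (trans (cong decode (sym eq)) (decode-code κ))
      κ<m : radius κ < m
      κ<m = ≰⇒> λ m≤r → separated κ (proj₂ (classify u))
        (subst (λ κ → Describes κ v) κ≡ (proj₂ (classify v))) u≢v (within-mono m≤r p)

    private
      DG : Graph
      DG = D G
      DV : Set
      DV = Graph.Vertex DG

    edges-adjacent : ∀ e → proj₁ (List.lookup edges e) ~ proj₂ (List.lookup edges e)
    edges-adjacent e = proj₂ (All.lookup
      (all-filter (λ ((u , v) : Vertex × Vertex) → (u <? v) ×-dec (u ~? v))
        (cartesianProduct (allFin order) (allFin order)))
      (∈-lookup e))

    shared-edge : ∀ {u v} e → Incident G u e → Incident G v e → u ≡ v ⊎ u ~ v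
    shared-edge e (inj₁ refl) (inj₁ refl) = inj₁ refl
    shared-edge e (inj₁ refl) (inj₂ refl) = inj₂ (edges-adjacent e)
    shared-edge e (inj₂ refl) (inj₁ refl) = inj₂ (~-sym (edges-adjacent e))
    shared-edge e (inj₂ refl) (inj₂ refl) = inj₁ refl

    -- Two consecutive edges of D G make at most one edge of G.
    contract : ∀ {d} (p : Vec DV (suc d)) → Linked (Graph._~_ DG) p → ∀ {u v} →
      splitAt order (head p) ≡ inj₁ u → splitAt order (last p) ≡ inj₁ v →
      ∃ λ m → d ≡ m + m × Within m u v
    contract (x ∷ [])         [-]       hx hl = 0 , refl , inj₁-injective (trans (sym hx) hl)
    contract (x ∷ y ∷ [])     (e ∷ [-]) hx hl = ⊥-elim (subst₂ (SubdivAdj G) hx hl e)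
    contract {suc (suc d)} (x ∷ y ∷ z ∷ p) (e ∷ f ∷ l) {u} {v} hx hl = via (splitAt order y) refl
      where
      via : ∀ s → splitAt order y ≡ s → ∃ λ m → suc (suc d) ≡ m + m × Within m u v
      via (inj₁ _) hy = ⊥-elim (subst₂ (SubdivAdj G) hx hy e)
      via (inj₂ a) hy = end (splitAt order z) refl
        where
        end : ∀ s → splitAt order z ≡ s → ∃ λ m → suc (suc d) ≡ m + m × Within m u v
        end (inj₂ _) hz = ⊥-elim (subst₂ (SubdivAdj G) hy hz f)
        end (inj₁ t) hz with contract (z ∷ p) l hz hl
        ... | m , refl , q = suc m , cong suc (sym (+-suc m m)) ,
          (case shared-edge a (subst₂ (SubdivAdj G) hx hy e) (subst₂ (SubdivAdj G) hy hz f) of λ where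
            (inj₁ refl) → inj₁ q
            (inj₂ ut)   → inj₂ (t , ut , q))

    paint : DV → Fin 6
    paint x = [ hue , const zero ]′ (splitAt order x)

    splitAt-injective : ∀ {x y : DV} → splitAt order x ≡ splitAt order y → x ≡ y
    splitAt-injective {x} {y} eq = trans (sym (join-splitAt order _ x))
      (trans (cong (join order _) eq) (join-splitAt order _ y))

    code≢zero : ∀ κ → code κ ≢ zero
    code≢zero (coloured false) ()
    code≢zero (coloured true)  ()
    code≢zero (token false)    ()
    code≢zero (token true)     ()
    code≢zero root             ()

    paint-packing : IsPackingColoring DG (oneTo 6) paint
    paint-packing x y x≢y eq d ((p , isPath starts ends linked _) , _) =
      go (splitAt order x) (splitAt order y) refl refl
      where
      go : ∀ s t → splitAt order x ≡ s → splitAt order y ≡ t → oneTo 6 (paint x) + 1 ≤ d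
      go (inj₁ u) (inj₁ v) hx hy with contract p linked (trans (cong (splitAt order) starts) hx)
                                                        (trans (cong (splitAt order) ends) hy)
      ... | m , refl , q = subst (λ s → oneTo 6 ([ hue , const zero ]′ s) + 1 ≤ m + m) (sym hx)
        (hue-separates (λ { refl → x≢y (splitAt-injective (trans hx (sym hy))) })
          (subst₂ (λ s t → [ hue , const zero ]′ s ≡ [ hue , const zero ]′ t) hx hy eq) q)
      go (inj₁ u) (inj₂ _) hx hy = contradiction
        (subst₂ (λ s t → [ hue , const zero ]′ s ≡ [ hue , const zero ]′ t) hx hy eq)
        (code≢zero (proj₁ (classify u)))
      go (inj₂ _) (inj₁ v) hx hy = contradiction
        (sym (subst₂ (λ s t → [ hue , const zero ]′ s ≡ [ hue , const zero ]′ t) hx hy eq))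
        (code≢zero (proj₁ (classify v)))
      -- Colour 1 asks only for distance 2, and subdivision vertices are pairwise nonadjacent.
      go (inj₂ a) (inj₂ b) hx hy = subst (λ s → oneTo 6 ([ hue , const zero ]′ s) + 1 ≤ d) (sym hx)
        (long p linked starts ends)
        where
        long : ∀ {d} (p : Vec DV (suc d)) → Linked (Graph._~_ DG) p → head p ≡ x → last p ≡ y → 2 ≤ d
        long (_ ∷ [])        [-]       refl ends = contradiction ends x≢y
        long (_ ∷ _ ∷ [])    (e ∷ [-]) refl refl = ⊥-elim (subst₂ (SubdivAdj G) hx hy e)
        long (_ ∷ _ ∷ _ ∷ _) _         _    _    = s≤s (s≤s z≤n)

corollary1p3 : (G : Graph) → Subcubic G → χₚ (D G) ≤ 6
corollary1p3 G subcubic = proj₂ (proj₂ (leastPackingColorable (D G))) 6 (paint , paint-packing)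
  where
  open SubcubicGraph G subcubic
  open Subdivide (Existence.packing (proj₁ fewest) (proj₂ fewest))
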